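{- Solving the GIF problem in the BSP or in the MapReduce model with $N=PM$ and $P=\Theta(M)=\Theta(\sqrt N)$ takes $\Omega(\log N)$ communication rounds.
   Context: BSP / MapReduce model: $P$ processors, each with a private memory of size $M$ and no other storage; computation proceeds in rounds, in each of which processors compute locally and then exchange data, each processor sending and receiving at most $M$ items; the cost is the number of communication rounds. Here data items are indivisible atoms representing closed intervals; local operations are copying, deleting, and fusing two atoms $x,y$ held by the same processor whose intervals intersect into a new atom representing $I_x\cup I_y$. GIF problem: there are initial atoms $x_1,\dots,x_N$, $x_i$ representing $[\pi(i)-1,\pi(i)]$ for a permutation $\pi$ of $[N]$ ($N$ a power of $2$) unknown to the algorithm. A boundary is a pair $(i,j)$ with $\pi(j)=\pi(i)+1$ (the point $\pi(i)$); when revealed, the algorithm learns that $x_i,x_j$ represent neighboring intervals. The task ends when an atom representing $[0,N]$ exists. Boundaries are revealed by the guide: $T$ is the perfect binary tree with $N$ leaves, the $k$-th leaf corresponding to $[k-1,k]$, each internal node corresponding to the boundary point between the rightmost leaf of its left subtree and the leftmost leaf of its right subtree; leaves have level $1$, root level $\log N$; whenever an existing atom represents $[a,b]$ with none of its interior boundary points $a,b$ revealed, the one whose tree node has smaller level is revealed (ties: $a$). -}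

module Defs where

open import Data.Nat using (ℕ; zero; suc; _+_; _*_; _∸_; _≤_; _<_; _⊓_; _⊔_; _≡ᵇ_; _<ᵇ_; _/_; _%_)
open import Data.Nat.Properties using (_<?_)
open import Data.Bool using (Bool; true; false; if_then_else_; _∧_; _∨_; not)
open import Data.Fin using (Fin; toℕ; fromℕ<; _≟_)
open import Data.List using (List; []; _∷_; _++_; length; map; concatMap; mapMaybe; allFin)
open import Data.Nat.ListAction using (sum)
open import Data.List.Relation.Unary.All using (All)
open import Data.List.Relation.Unary.Any using (Any)
open import Data.Maybe using (Maybe; just; nothing)
open import Data.Product using (_×_; _,_; proj₁; proj₂; ∃)
open import Function.Bundles using (_↔_; Inverse)
open import Relation.Nullary using (does; yes; no)
open import Relation.Binary.PropositionalEquality using (_≡_; _≢_)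
open import Relation.Binary.Construct.Closure.ReflexiveTransitive using (Star)

nth : {A : Set} → List A → ℕ → Maybe A
nth []       _       = nothing
nth (x ∷ xs) zero    = just x
nth (x ∷ xs) (suc k) = nth xs k

removeAt : {A : Set} → List A → ℕ → List A
removeAt []       _       = []
removeAt (x ∷ xs) zero    = xs
removeAt (x ∷ xs) (suc k) = x ∷ removeAt xs k

count : {A : Set} → (A → Bool) → List A → ℕ
count p []       = 0
count p (x ∷ xs) = (if p x then 1 else 0) + count p xs

elemℕ : ℕ → List ℕ → Bool
elemℕ x []       = false
elemℕ x (y ∷ ys) = (x ≡ᵇ y) ∨ elemℕ x ys

-- Levels of boundary points in the perfect binary tree T.
-- The internal node of T at boundary point b (1 ≤ b ≤ N-1) is the node
-- whose subtrees are the blocks ending/starting at b; its height above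
-- the leaves is 1 + (number of trailing zero bits of b).  With the
-- paper's numbering (root has level log N) the level of point b is
-- 1 + tz b; only comparisons of levels matter.

tz′ : ℕ → ℕ → ℕ
tz′ zero    _ = 0
tz′ (suc f) b = if ((b % 2) ≡ᵇ 0) ∧ not (b ≡ᵇ 0) then suc (tz′ f (b / 2)) else 0

tz : ℕ → ℕ
tz b = tz′ b b

level : ℕ → ℕ
level b = suc (tz b)

-- The guide: for an atom representing [a,b] in a world with N unit
-- intervals, given the list K of already revealed boundary points,
-- the list of points newly revealed (empty or a singleton).
-- 0 and N are not boundary points.
guide : (N : ℕ) → List ℕ → ℕ → ℕ → List ℕ
guide N K a b =
  if a ≡ᵇ 0
  then (if b ≡ᵇ N then [] else (if elemℕ b K then [] else b ∷ []))
  else (if b ≡ᵇ N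
        then (if elemℕ a K then [] else a ∷ [])
        else (if elemℕ a K ∨ elemℕ b K then []
              else (if level b <ᵇ level a then b ∷ [] else a ∷ [])))

module _ (P M : ℕ) where

  -- initial atoms x_i are indexed by (processor, slot); processor p
  -- initially holds the M atoms (p , m).
  Leaf : Set
  Leaf = Fin P × Fin M

  -- the permutation π : leaf ↦ position; leaf i represents
  -- [toℕ (π i) , toℕ (π i) + 1]  (0-based version of [π(i)-1, π(i)])
  Perm : Set
  Perm = Leaf ↔ Fin (P * M)

  -- atoms, as seen by the algorithm: their fusion history
  data Atom : Set where
    leaf : Fin P → Fin M → Atom
    fuse : Atom → Atom → Atom

  record View : Set where
    field
      rnd    : ℕ
      self   : Fin P
      memory : List Atom
      known  : List (Leaf × Leaf) -- revealed boundaries (i , j), π j = π i + 1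

  data Op : Set where
    copy   : ℕ → Op
    delete : ℕ → Op
    fuseOp : ℕ → ℕ → Op
    done   : Op

  record Strategy : Set where
    field
      local : View → Op
      -- communication: list of (index of atom in memory , destination);
      -- atoms not listed are discarded, destination = self means "keep"
      comm  : View → List (ℕ × Fin P)

  Cell : Set
  Cell = Atom × ℕ × ℕ

  lo hi : Cell → ℕ
  lo c = proj₁ (proj₂ c)
  hi c = proj₂ (proj₂ c)

  record Config : Set where
    field
      rnd  : ℕ
      K    : List ℕ             -- globally revealed boundary points
      mems : Fin P → List Cell
      locK : Fin P → List ℕ     -- points revealed to p during this round
      fin  : Fin P → Bool

  open Config public

  upd : {A : Set} → (Fin P → A) → Fin P → A → Fin P → A
  upd f p x q = if does (q ≟ p) then x else f q

  module _ (π : Perm) (s : Strategy) where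

    leafAt : ℕ → Maybe Leaf
    leafAt k with k <? P * M
    ... | yes k<N = just (Inverse.from π (fromℕ< k<N))
    ... | no  _   = nothing

    pairOf : ℕ → Maybe (Leaf × Leaf)
    pairOf zero = nothing
    pairOf (suc b) with leafAt b | leafAt (suc b)
    ... | just i | just j = just (i , j)
    ... | _      | _      = nothing

    viewOf : Config → Fin P → View
    viewOf c p = record
      { rnd    = rnd c
      ; self   = p
      ; memory = map proj₁ (mems c p)
      ; known  = mapMaybe pairOf (K c ++ locK c p) }

    plan : Config → Fin P → List (ℕ × Fin P)
    plan c p = comm (viewOf c p) where open Strategy s

    sentTo : Config → Fin P → Fin P → List Cell
    sentTo c p q = mapMaybe
      (λ e → if does (proj₂ e ≟ q) then nth (mems c p) (proj₁ e) else nothing)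
      (plan c p)

    newMem : Config → Fin P → List Cell
    newMem c q = concatMap (λ p → sentTo c p q) (allFin P)

    sentOut : Config → Fin P → ℕ
    sentOut c p = count (λ e → not (does (proj₂ e ≟ p))) (plan c p)

    received : Config → Fin P → ℕ
    received c q = sum (map (λ p → if does (p ≟ q) then 0
                                   else count (λ e → does (proj₂ e ≟ q)) (plan c p))
                            (allFin P))

    record CommOK (c : Config) : Set where
      field
        validIdx : ∀ p → All (λ e → proj₁ e < length (mems c p)) (plan c p)
        sendBd   : ∀ p → sentOut c p ≤ M
        recvBd   : ∀ q → received c q ≤ M
        memBd    : ∀ q → length (newMem c q) ≤ M

    commResult : Config → Config
    commResult c = record
      { rnd  = suc (rnd c)
      ; K    = K c ++ concatMap (locK c) (allFin P)
      ; mems = newMem c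
      ; locK = λ _ → []
      ; fin  = λ _ → false }

    data Step : Config → Config → Set where
      sCopy : ∀ {c p k x} → fin c p ≡ false →
              Strategy.local s (viewOf c p) ≡ copy k →
              nth (mems c p) k ≡ just x →
              length (mems c p) < M →
              Step c (record c { mems = upd (mems c) p (mems c p ++ x ∷ []) })
      sDelete : ∀ {c p k x} → fin c p ≡ false →
              Strategy.local s (viewOf c p) ≡ delete k →
              nth (mems c p) k ≡ just x →
              Step c (record c { mems = upd (mems c) p (removeAt (mems c p) k) })
      sFuse : ∀ {c p k l x y a b a′ b′} → fin c p ≡ false →
              Strategy.local s (viewOf c p) ≡ fuseOp k l →
              k ≢ l →
              nth (mems c p) k ≡ just (x , a , b) →
              nth (mems c p) l ≡ just (y , a′ , b′) →
              a′ ≤ b → a ≤ b′ →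
              Step c (record c
                { mems = upd (mems c) p
                    (removeAt (removeAt (mems c p) (k ⊔ l)) (k ⊓ l)
                      ++ (fuse x y , a ⊓ a′ , b ⊔ b′) ∷ [])
                ; locK = upd (locK c) p
                    (locK c p ++ guide (P * M) (K c ++ locK c p) (a ⊓ a′) (b ⊔ b′)) })
      sDone : ∀ {c p} → fin c p ≡ false →
              Strategy.local s (viewOf c p) ≡ done →
              Step c (record c { fin = upd (fin c) p true })
      sComm : ∀ {c} → (∀ p → fin c p ≡ true) → CommOK c →
              Step c (commResult c)

    initMem : Fin P → List Cell
    initMem p = map (λ m → leaf p m , toℕ (Inverse.to π (p , m)) , suc (toℕ (Inverse.to π (p , m))))
                    (allFin M)

    revealSeq : List ℕ → List Cell → List ℕ
    revealSeq K₀ []       = K₀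
    revealSeq K₀ (x ∷ xs) = revealSeq (K₀ ++ guide (P * M) K₀ (lo x) (hi x)) xs

    init : Config
    init = record
      { rnd  = 0
      ; K    = revealSeq [] (concatMap initMem (allFin P))
      ; mems = initMem
      ; locK = λ _ → []
      ; fin  = λ _ → false }

    HasFull : Config → Set
    HasFull c = ∃ λ p → Any (λ x → lo x ≡ 0 × hi x ≡ P * M) (mems c p)

  SolvesWithin : Strategy → ℕ → Set
  SolvesWithin s R = ∀ (π : Perm) → ∃ λ c →
    Star (Step π s) (init π s) c × rnd c ≤ R × HasFull π s c

-- Call a multiple c of 2^(r+1) bad in round r if, at the beginning of that round, some processor
-- holds an atom ending at c and an atom starting at c.  Without such a contact c cannot be crossed
-- during the round, so a multiple of 2^(R+1) that is never bad stays uncrossed for R+1 rounds, and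
-- no atom represents [0,N] by then.  Hence it is enough to find a permutation with fewer than about
-- N / 2^(R+1) bad points.
--
-- It is built round by round.  The guide reveals an end of an aligned block of size w = 2^(t+1) only
-- to an atom covering a neighbouring block.  So if no point near two such blocks was bad before
-- round t, exchanging the blocks does not change what the algorithm has seen by the beginning of
-- round t.  The exchange removes a bad point at the end of one block, and it creates no new one
-- unless newly adjacent blocks have atoms in a common memory.  There are only (t+1) P M² such
-- contacts, so a harmless exchange exists as long as more than about t w M bad points of round t are
-- next to blocks that can be exchanged.  The number of bad points therefore starts at 2^O(R) M and
-- grows by a constant factor per round; it stays below N / 2^(R+1) when P ≥ 2^(6R+12).

module Submission where

open import Defs
open import Data.Bool using (Bool; true; false; if_then_else_; _∨_; T)
open import Data.Empty using (⊥; ⊥-elim)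
open import Data.Fin using (Fin; toℕ; fromℕ<)
import Data.Fin as Fin
open import Data.Fin.Properties using (toℕ-fromℕ<; toℕ-injective; toℕ<n; *↔×)
open import Data.List using (List; []; _∷_; _++_; length; map; concatMap; mapMaybe; filter; allFin; upTo; cartesianProduct; cartesianProductWith)
open import Data.List.Membership.Propositional using (_∈_; _∉_; find; lose)
open import Data.List.Membership.Propositional.Properties
open import Data.List.Properties hiding (tabulate-cong; ≡-dec)
open import Data.List.Relation.Unary.All as All using (All; []; _∷_)
import Data.List.Relation.Unary.All.Properties as All
open import Data.List.Relation.Unary.AllPairs using ([]; _∷_)
open import Data.List.Relation.Unary.Any using (any?; here; there)
open import Data.List.Relation.Unary.Unique.Propositional using (Unique)
import Data.List.Relation.Unary.Unique.Propositional.Properties as Unique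
import Data.List.Membership.DecPropositional as DecMembership
open import Data.Maybe as Maybe using (Maybe; just; nothing)
import Data.Maybe.Relation.Unary.All as MaybeAll
open import Data.Nat
open import Data.Nat.DivMod hiding (result)
open import Data.Nat.Divisibility
open import Data.Nat.Properties
open import Data.Nat.Tactic.RingSolver using (solve-∀)
open import Data.Product using (_×_; _,_; proj₁; proj₂; ∃)
open import Data.Product.Properties using (≡-dec)
open import Data.Sum using (_⊎_; inj₁; inj₂)
open import Data.Vec as Vec using (Vec; lookup; tabulate)
open import Data.Vec.Properties using (lookup∘tabulate; tabulate-cong; lookup-map; tabulate-∘)
open import Function using (_∘_)
open import Function.Bundles using (mk⇔; mk↔ₛ′; Inverse)
open import Function.Properties.Inverse using (↔-sym; ↔-trans)
open import Relation.Binary.Construct.Closure.ReflexiveTransitive using (Star; ε; _◅_; _◅◅_)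
open import Relation.Binary.Definitions using (DecidableEquality)
open import Relation.Binary.PropositionalEquality
open import Relation.Nullary using (¬_; Dec; yes; no; contradiction; ¬?; does)
open import Relation.Nullary.Decidable using (does-⇔; decidable-stable; _×-dec_)

-- Levels of boundary points

2^tz′∣ : ∀ f b → 2 ^ tz′ f b ∣ b
2^tz′∣ zero    b = 1∣ b
2^tz′∣ (suc f) b with b % 2 in b%2≡ | b ≡ᵇ 0
... | suc _ | _     = 1∣ b
... | zero  | true  = 1∣ b
... | zero  | false = subst (2 * 2 ^ tz′ f (b / 2) ∣_) (m*[n/m]≡n (m%n≡0⇒n∣m b 2 b%2≡))
                        (*-monoʳ-∣ 2 (2^tz′∣ f (b / 2)))

-- The fuel `f` never runs out before the factors 2 do, because it starts no smaller than `b` and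
-- halving lowers `b` by at least as much as the fuel.
∣⇒≤tz′ : ∀ f b j → b ≤ f → 0 < b → 2 ^ j ∣ b → j ≤ tz′ f b
∣⇒≤tz′ f       b        zero    _   _   _   = z≤n
∣⇒≤tz′ zero    (suc b)  (suc j) ()
∣⇒≤tz′ (suc f) b@(suc _) (suc j) b≤f 0<b 2^∣b
  rewrite n∣m⇒m%n≡0 b 2 (∣-trans (m∣m*n (2 ^ j)) 2^∣b) =
  s≤s (∣⇒≤tz′ f (b / 2) j (≤-pred (≤-trans (m/n<m b 2 (s≤s (s≤s z≤n))) b≤f)) 0<b/2 2^j∣b/2)
  where
  2^j∣b/2 : 2 ^ j ∣ b / 2
  2^j∣b/2 = *-cancelˡ-∣ 2 (subst (2 * 2 ^ j ∣_) (sym (m*[n/m]≡n (∣-trans (m∣m*n (2 ^ j)) 2^∣b))) 2^∣b)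
  0<b/2 : 0 < b / 2
  0<b/2 = m≥n⇒m/n>0 {b} {2} (∣⇒≤ (∣-trans (m∣m*n (2 ^ j)) 2^∣b))

2^tz∣ : ∀ b → 2 ^ tz b ∣ b
2^tz∣ b = 2^tz′∣ b b

∣⇒≤tz : ∀ {b} j → 0 < b → 2 ^ j ∣ b → j ≤ tz b
∣⇒≤tz {b} j = ∣⇒≤tz′ b b j ≤-refl

2^-mono-∣ : ∀ {j k} → j ≤ k → 2 ^ j ∣ 2 ^ k
2^-mono-∣ {j} {k} j≤k = divides (2 ^ (k ∸ j)) (trans (cong (2 ^_) (sym (m∸n+n≡m j≤k))) (^-distribˡ-+-* 2 (k ∸ j) j))

-- The guide reveals the end of lower level. By this lemma, if the revealed end is a multiple of the
-- block size, then so is the other end.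
level≤⇒∣ : ∀ {a b} j → 0 < b → level b ≤ level a → 2 ^ j ∣ b → 2 ^ j ∣ a
level≤⇒∣ {a} j 0<b lb≤la 2^j∣b =
  ∣-trans (2^-mono-∣ (≤-trans (∣⇒≤tz j 0<b 2^j∣b) (≤-pred lb≤la))) (2^tz∣ a)

∤⇒tz< : ∀ {x} j → ¬ 2 ^ j ∣ x → tz x < j
∤⇒tz< {x} j j∤x = ≰⇒> λ j≤ → j∤x (∣-trans (2^-mono-∣ j≤) (2^tz∣ x))

∤∣⇒level< : ∀ {x y} j → 0 < y → ¬ 2 ^ j ∣ x → 2 ^ j ∣ y → level x < level y
∤∣⇒level< j 0<y j∤x j∣y = s≤s (≤-trans (∤⇒tz< j j∤x) (∣⇒≤tz j 0<y j∣y))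

%≡⇒∣ : ∀ {d w x y} .{{_ : NonZero w}} → d ∣ w → x % w ≡ y % w → d ∣ x → d ∣ y
%≡⇒∣ {d} {w} {x} {y} d∣w x%≡y% d∣x =
  subst (d ∣_) (sym (m≡m%n+[m/n]*n y w)) (∣m∣n⇒∣m+n (subst (d ∣_) x%≡y% d∣x%w) (∣n⇒∣m*n (y / w) d∣w))
  where
  d∣x%w : d ∣ x % w
  d∣x%w = ∣m+n∣m⇒∣n (subst (d ∣_) (trans (m≡m%n+[m/n]*n x w) (+-comm (x % w) _)) d∣x) (∣n⇒∣m*n (x / w) d∣w)

∤⇒0< : ∀ {d x} → ¬ d ∣ x → 0 < x
∤⇒0< {d} {zero}  d∤x = contradiction (d ∣0) d∤x
∤⇒0< {d} {suc x} d∤x = s≤s z≤n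

module _ {w j : ℕ} .{{_ : NonZero w}} (w≡2^j : w ≡ 2 ^ j) where

  -- The level of a point that is no multiple of `w` is decided by its residue modulo `w`, since the
  -- power of 2 that fixes it divides `w`.
  %≡⇒level≤ : ∀ {x y} → x % w ≡ y % w → ¬ w ∣ x → 0 < y → level x ≤ level y
  %≡⇒level≤ {x} eq w∤x 0<y = s≤s (∣⇒≤tz (tz x) 0<y (%≡⇒∣ 2^tz∣w eq (2^tz∣ x)))
    where
    2^tz∣w : 2 ^ tz x ∣ w
    2^tz∣w = subst (2 ^ tz x ∣_) (sym w≡2^j)
               (2^-mono-∣ (<⇒≤ (∤⇒tz< j (λ j∣x → w∤x (subst (_∣ x) (sym w≡2^j) j∣x)))))

  %≡⇒level≡ : ∀ {x y} → x % w ≡ y % w → ¬ w ∣ x → level x ≡ level y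
  %≡⇒level≡ {x} {y} eq w∤x =
    ≤-antisym (%≡⇒level≤ eq w∤x (∤⇒0< w∤y)) (%≡⇒level≤ (sym eq) w∤y (∤⇒0< w∤x))
    where
    w∤y : ¬ w ∣ y
    w∤y w∣y = w∤x (%≡⇒∣ ∣-refl (sym eq) w∣y)

-- Exchanging two blocks

transpose : ℕ → ℕ → ℕ → ℕ
transpose i j k with k ≟ i | k ≟ j
... | yes _ | _     = j
... | no _  | yes _ = i
... | no _  | no _  = k

transpose-fst : ∀ i j → transpose i j i ≡ j
transpose-fst i j with i ≟ i | i ≟ j
... | yes _  | _ = refl
... | no i≢i | _ = contradiction refl i≢i

transpose-snd : ∀ i j → transpose i j j ≡ i
transpose-snd i j with j ≟ i | j ≟ j
... | yes j≡i | _       = j≡i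
... | no _    | yes _   = refl
... | no _    | no j≢j  = contradiction refl j≢j

transpose-other : ∀ {i j k} → k ≢ i → k ≢ j → transpose i j k ≡ k
transpose-other {i} {j} {k} k≢i k≢j with k ≟ i | k ≟ j
... | yes k≡i | _       = contradiction k≡i k≢i
... | no _    | yes k≡j = contradiction k≡j k≢j
... | no _    | no _    = refl

transpose-involutive : ∀ i j k → transpose i j (transpose i j k) ≡ k
transpose-involutive i j k with k ≟ i | k ≟ j
... | yes refl | _        = transpose-snd i j
... | no _     | yes refl = transpose-fst i j
... | no k≢i   | no k≢j   = transpose-other k≢i k≢j

transpose-< : ∀ {i j k n} → i < n → j < n → k < n → transpose i j k < n
transpose-< {i} {j} {k} i<n j<n k<n with k ≟ i | k ≟ j
... | yes _ | _     = j<n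
... | no _  | yes _ = i<n
... | no _  | no _  = k<n

module BlockSwap (w : ℕ) .{{_ : NonZero w}} (i j : ℕ) where

  sw : ℕ → ℕ
  sw = transpose i j

  opaque
    τ : ℕ → ℕ
    τ x = x % w + sw (x / w) * w

  -- Action on right endpoints: the unit interval ending at b moves with its left endpoint b ∸ 1.
  τʳ : ℕ → ℕ
  τʳ b = suc (τ (pred b))

  [r+kw]% : ∀ r k → r < w → (r + k * w) % w ≡ r
  [r+kw]% r k r<w = trans ([m+kn]%n≡m%n r k w) (m<n⇒m%n≡m r<w)

  [r+kw]/ : ∀ r k → r < w → (r + k * w) / w ≡ k
  [r+kw]/ r k r<w = begin
    (r + k * w) / w      ≡⟨ +-distrib-/-∣ʳ r (n∣m*n k) ⟩
    r / w + k * w / w    ≡⟨ cong₂ _+_ (m<n⇒m/n≡0 r<w) (m*n/n≡m k w) ⟩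
    k                    ∎
    where open ≡-Reasoning

  opaque
    unfolding τ

    τ-% : ∀ x → τ x % w ≡ x % w
    τ-% x = [r+kw]% (x % w) (sw (x / w)) (m%n<n x w)

    τ-/ : ∀ x → τ x / w ≡ sw (x / w)
    τ-/ x = [r+kw]/ (x % w) (sw (x / w)) (m%n<n x w)

    τ-+* : ∀ r k → r < w → τ (r + k * w) ≡ r + sw k * w
    τ-+* r k r<w = cong₂ (λ r′ k′ → r′ + sw k′ * w) ([r+kw]% r k r<w) ([r+kw]/ r k r<w)

    τ-* : ∀ k → τ (k * w) ≡ sw k * w
    τ-* k = τ-+* 0 k (>-nonZero⁻¹ w)

    τ-involutive : ∀ x → τ (τ x) ≡ x
    τ-involutive x = begin
      τ (τ x)                             ≡⟨ cong₂ (λ r k → r + sw k * w) (τ-% x) (τ-/ x) ⟩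
      x % w + sw (sw (x / w)) * w         ≡⟨ cong (λ k → x % w + k * w) (transpose-involutive i j (x / w)) ⟩
      x % w + x / w * w                   ≡⟨ m≡m%n+[m/n]*n x w ⟨
      x                                   ∎
      where open ≡-Reasoning

  τ-injective : ∀ {x y} → τ x ≡ τ y → x ≡ y
  τ-injective {x} {y} eq = trans (sym (τ-involutive x)) (trans (cong τ eq) (τ-involutive y))

  τʳ-injective : ∀ {x y} → 0 < x → 0 < y → τʳ x ≡ τʳ y → x ≡ y
  τʳ-injective {suc x} {suc y} _ _ eq = cong suc (τ-injective (suc-injective eq))

  τʳ-involutive : ∀ {x} → 0 < x → τʳ (τʳ x) ≡ x
  τʳ-involutive {suc x} _ = cong suc (τ-involutive x)

  opaque
    unfolding τ

    τ-< : ∀ {n x} → i < n → j < n → x < n * w → τ x < n * w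
    τ-< {n} {x} i<n j<n x<nw = begin-strict
      x % w + sw (x / w) * w   <⟨ +-monoˡ-< (sw (x / w) * w) (m%n<n x w) ⟩
      suc (sw (x / w)) * w     ≤⟨ *-monoˡ-≤ w (transpose-< i<n j<n (m<n*o⇒m/o<n x<nw)) ⟩
      n * w                    ∎
      where open ≤-Reasoning

  -- The ends of the two blocks: the only points at which the exchange can separate two adjacent
  -- unit intervals.
  data Break : ℕ → Set where
    break-i  : Break (i * w)
    break-i′ : Break (suc i * w)
    break-j  : Break (j * w)
    break-j′ : Break (suc j * w)

  ∣break : ∀ {c} → Break c → w ∣ c
  ∣break break-i  = n∣m*n i
  ∣break break-i′ = n∣m*n (suc i)
  ∣break break-j  = n∣m*n j
  ∣break break-j′ = n∣m*n (suc j)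

  opaque
    unfolding τ

    -- Within a block both points move together. Otherwise `suc x` is a multiple of `w`, and since
    -- it is no break, the blocks on both sides of it stay in place.
    τ-suc : ∀ x → ¬ Break (suc x) → τ (suc x) ≡ suc (τ x)
    τ-suc x ¬brk with suc (x % w) <? w
    ... | yes r<w = begin
      τ (suc x)                           ≡⟨ cong (λ y → τ (suc y)) (m≡m%n+[m/n]*n x w) ⟩
      τ (suc (x % w) + x / w * w)         ≡⟨ τ-+* (suc (x % w)) (x / w) r<w ⟩
      suc (τ x)                           ∎
      where open ≡-Reasoning
    ... | no r≮w = begin
      τ (suc x)                           ≡⟨ cong τ x≡ ⟩
      τ (suc k * w)                       ≡⟨ τ-* (suc k) ⟩
      sw (suc k) * w                      ≡⟨ cong (_* w) (transpose-other {i} {j} (k≢ break-i) (k≢ break-j)) ⟩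
      suc k * w                           ≡⟨ cong (λ l → suc l * w) (transpose-other {i} {j} (λ k≡i → k≢ break-i′ (cong suc k≡i)) (λ k≡j → k≢ break-j′ (cong suc k≡j))) ⟨
      suc (sw k) * w                      ≡⟨ cong (_+ sw k * w) r≡w ⟨
      suc (τ x)                           ∎
      where
      open ≡-Reasoning
      k : ℕ
      k = x / w
      r≡w : suc (x % w) ≡ w
      r≡w = ≤-antisym (m%n<n x w) (≮⇒≥ r≮w)
      x≡ : suc x ≡ suc k * w
      x≡ = trans (cong suc (m≡m%n+[m/n]*n x w)) (cong (_+ k * w) r≡w)
      k≢ : ∀ {l} → Break (l * w) → suc k ≢ l
      k≢ b refl = ¬brk (subst Break (sym x≡) b)

  ¬Break⇒τ≡τʳ : ∀ {c} → 0 < c → ¬ Break c → τ c ≡ τʳ c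
  ¬Break⇒τ≡τʳ {suc c} _ = τ-suc c

  opaque
    unfolding τ

    τʳ-* : ∀ k → τʳ (suc k * w) ≡ suc (sw k) * w
    τʳ-* k = begin
      suc (τ (pred (w + k * w)))          ≡⟨ cong (λ v → suc (τ (pred (v + k * w)))) (suc-pred w) ⟨
      suc (τ (pred w + k * w))            ≡⟨ cong suc (τ-+* (pred w) k (subst (pred w <_) (suc-pred w) (n<1+n (pred w)))) ⟩
      suc (pred w) + sw k * w             ≡⟨ cong (_+ sw k * w) (suc-pred w) ⟩
      suc (sw k) * w                      ∎
      where open ≡-Reasoning

-- The answers of the guide under an exchange

multiples-gap : ∀ {w a b} → w ∣ a → w ∣ b → a < b → a + w ≤ b
multiples-gap {w} (divides-refl q) (divides-refl r) a<b =
  subst (_≤ r * w) (+-comm w (q * w)) (*-monoˡ-≤ w (*-cancelʳ-< w q r a<b))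

-- This is `guide` with the outcomes of its tests as arguments, so that its answers before and after
-- an exchange can be compared test by test.
guideBy : (a≡0 b≡N a∈K b∈K lb<la : Bool) → ℕ → ℕ → List ℕ
guideBy a≡0 b≡N a∈K b∈K lb<la a b =
  if a≡0
  then (if b≡N then [] else (if b∈K then [] else b ∷ []))
  else (if b≡N
        then (if a∈K then [] else a ∷ [])
        else (if a∈K ∨ b∈K then []
              else (if lb<la then b ∷ [] else a ∷ [])))

-- Left and right endpoints move by different maps `f` and `g`. A revealed point satisfies `Q`,
-- where the two agree, so it does not matter as which end it was revealed.
guideBy-map : ∀ (f g : ℕ → ℕ) {Q : ℕ → Set} (f≡g : ∀ {x} → Q x → f x ≡ g x) {a b} z n ea eb l l′ →
  All Q (guideBy z n ea eb l a b) → (z ≡ false → n ≡ false → l′ ≡ l) →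
  guideBy z n ea eb l′ (f a) (g b) ≡ map f (guideBy z n ea eb l a b)
guideBy-map f g f≡g true  true  ea    eb    l l′ qs        l′≡l = refl
guideBy-map f g f≡g true  false ea    true  l l′ qs        l′≡l = refl
guideBy-map f g f≡g true  false ea    false l l′ (q ∷ [])  l′≡l = cong (_∷ []) (sym (f≡g q))
guideBy-map f g f≡g false true  true  eb    l l′ qs        l′≡l = refl
guideBy-map f g f≡g false true  false eb    l l′ qs        l′≡l = refl
guideBy-map f g f≡g false false true  eb    l l′ qs        l′≡l = refl
guideBy-map f g f≡g false false false true  l l′ qs        l′≡l = refl
guideBy-map f g f≡g false false false false l l′ qs        l′≡l rewrite l′≡l refl refl with l | qs
... | true  | q ∷ [] = cong (_∷ []) (sym (f≡g q))
... | false | _      = refl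

-- What is retained about a revealed end: the opposite end is 0 or `N`, or its level is at least as
-- high.
data Reveals (N a b : ℕ) : ℕ → Set where
  right : 0 < b → a ≡ 0 ⊎ level b ≤ level a → Reveals N a b b
  left  : 0 < a → b ≡ N ⊎ level a ≤ level b → Reveals N a b a

guide-reveals : ∀ N K {a b} → a < b → All (Reveals N a b) (guide N K a b)
guide-reveals N K {zero} {b} a<b with b ≡ᵇ N | elemℕ b K
... | true  | _     = []
... | false | true  = []
... | false | false = right a<b (inj₁ refl) ∷ []
guide-reveals N K {a@(suc _)} {b} a<b with b ≡ᵇ N in b≡N | elemℕ a K | elemℕ b K | level b <ᵇ level a in lb<la
... | true  | true  | _     | _     = []
... | true  | false | _     | _     = left (s≤s z≤n) (inj₁ (≡ᵇ⇒≡ b N (subst T (sym b≡N) _))) ∷ []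
... | false | true  | _     | _     = []
... | false | false | true  | _     = []
... | false | false | false | true  = right (≤-<-trans z≤n a<b) (inj₂ (<⇒≤ (<ᵇ⇒< (level b) (level a) (subst T (sym lb<la) _)))) ∷ []
... | false | false | false | false = left (s≤s z≤n) (inj₂ (≮⇒≥ (λ lt → subst T lb<la (<⇒<ᵇ lt)))) ∷ []

elemℕ-map : ∀ (f g : ℕ → ℕ) {Q : ℕ → Set} {x xs} → (∀ {y} → Q y → f x ≡ g y → x ≡ y) →
  (∀ {y} → Q y → x ≡ y → f x ≡ g y) → All Q xs → elemℕ (f x) (map g xs) ≡ elemℕ x xs
elemℕ-map f g inj cng []       = refl
elemℕ-map f g {x = x} {y ∷ ys} inj cng (q ∷ qs) =
  cong₂ _∨_ (does-⇔ (mk⇔ (inj q) (cng q)) (f x ≟ g y) (x ≟ y)) (elemℕ-map f g inj cng qs)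

Uncrossed : ℕ → ℕ → ℕ → Set
Uncrossed z a b = b ≤ z ⊎ z ≤ a

-- Neither the first nor the last block takes part, so 0 and `N`, which the guide treats specially,
-- are fixed.
module SwapGuide (t : ℕ) (w : ℕ) (w≡ : w ≡ 2 ^ suc t) .{{_ : NonZero w}} (N nw i j : ℕ) (N≡ : N ≡ nw * w)
  (0<i : 0 < i) (0<j : 0 < j) (i<nw : suc i < nw) (j<nw : suc j < nw) where

  open BlockSwap w i j public

  m = 2 ^ t

  m<w : m < w
  m<w = subst (m <_) (sym w≡) (^-monoʳ-< 2 (s≤s (s≤s z≤n)) (n<1+n t))

  0<m : 0 < m
  0<m = m^n>0 2 t

  -- Besides a break `c`, the points half a block away from it are guarded: an interval that has an
  -- end at `c` and crosses none of them has length at most `m`, half a block. The form `z + m ≡ c`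
  -- avoids truncated subtraction.
  data Guard (c : ℕ) : ℕ → Set where
    at     : Guard c c
    after  : Guard c (c + m)
    before : ∀ {z} → z + m ≡ c → Guard c z

  record Safe (a b : ℕ) : Set where
    constructor safe
    field
      a<b : a < b
      uncrossed : ∀ {c z} → Break c → Guard c z → Uncrossed z a b

  open Safe

  -- A safe interval ending at a break has length at most `m`, but two distinct multiples of `w` are
  -- at least `w` apart. The same reason, mirrored, gives `safe-left`.
  safe-right : ∀ {a b} → Safe a b → w ∣ a → ¬ Break b
  safe-right {a} {b} s w∣a brk with uncrossed s brk (before b∸m+m≡b)
    where
    b∸m+m≡b : (b ∸ m) + m ≡ b
    b∸m+m≡b = m∸n+n≡m (≤-trans (<⇒≤ m<w) (≤-trans (m≤n+m w a) (multiples-gap w∣a (∣break brk) (a<b s))))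
  ... | inj₁ b≤b∸m = <-irrefl refl (<-≤-trans (∸-monoʳ-< 0<m (≤-trans (<⇒≤ m<w) (≤-trans (m≤n+m w a) (multiples-gap w∣a (∣break brk) (a<b s))))) b≤b∸m)
  ... | inj₂ b∸m≤a = <-irrefl refl (begin-strict
    a + m        <⟨ +-monoʳ-< a m<w ⟩
    a + w        ≤⟨ multiples-gap w∣a (∣break brk) (a<b s) ⟩
    b            ≤⟨ m≤n+m∸n b m ⟩
    m + (b ∸ m)  ≤⟨ +-monoʳ-≤ m b∸m≤a ⟩
    m + a        ≡⟨ +-comm m a ⟩
    a + m        ∎)
    where open ≤-Reasoning

  safe-left : ∀ {a b} → Safe a b → w ∣ b → ¬ Break a
  safe-left {a} {b} s w∣b brk with uncrossed s brk after
  ... | inj₁ b≤a+m = <-irrefl refl (<-≤-trans (+-monoʳ-< a m<w) (≤-trans (multiples-gap (∣break brk) w∣b (a<b s)) b≤a+m))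
  ... | inj₂ a+m≤a = <-irrefl refl (<-≤-trans (m<m+n a 0<m) a+m≤a)

  w∣-mono : ∀ {a b} → 0 < b → level b ≤ level a → w ∣ b → w ∣ a
  w∣-mono {a} {b} 0<b le w∣b = subst (_∣ a) (sym w≡) (level≤⇒∣ (suc t) 0<b le (subst (_∣ b) w≡ w∣b))

  -- At such points `τ` and `τʳ` agree, and the two leaves meeting there still meet after the
  -- exchange. All points revealed in a transported history are of this kind.
  Interior : ℕ → Set
  Interior c = 0 < c × ¬ Break c

  -- If the revealed end were a break, the opposite end would be a multiple of `w` too: 0 and `N`
  -- are, and any other one has at least the level of the break. Safety forbids this.
  reveals⇒interior : ∀ {a b x} → Safe a b → Reveals N a b x → Interior x
  reveals⇒interior {a} {b} s (right 0<b h) = 0<b , λ brk → safe-right s (w∣a h brk) brk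
    where
    w∣a : a ≡ 0 ⊎ level b ≤ level a → Break b → w ∣ a
    w∣a (inj₁ refl) brk = w ∣0
    w∣a (inj₂ le)   brk = w∣-mono 0<b le (∣break brk)
  reveals⇒interior {a} {b} s (left 0<a h) = 0<a , λ brk → safe-left s (w∣b h brk) brk
    where
    w∣b : b ≡ N ⊎ level a ≤ level b → Break a → w ∣ b
    w∣b (inj₁ refl) brk = subst (w ∣_) (sym N≡) (n∣m*n nw)
    w∣b (inj₂ le)   brk = w∣-mono 0<a le (∣break brk)

  guide-interior : ∀ K {a b} → Safe a b → All Interior (guide N K a b)
  guide-interior K s = All.map (reveals⇒interior s) (guide-reveals N K (a<b s))

  τ-0 : τ 0 ≡ 0
  τ-0 = trans (τ-* 0) (cong (_* w) (transpose-other {i} {j} {0} (λ { refl → <-irrefl refl 0<i }) (λ { refl → <-irrefl refl 0<j })))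

  -- N is the right end of the block nw ∸ 1, which is not moved.
  τʳ-N : τʳ N ≡ N
  τʳ-N = begin
    τʳ N                       ≡⟨ cong τʳ N≡ ⟩
    τʳ (nw * w)                ≡⟨ cong (λ k → τʳ (k * w)) (suc-pred nw) ⟨
    τʳ (suc (pred nw) * w)     ≡⟨ τʳ-* (pred nw) ⟩
    suc (sw (pred nw)) * w     ≡⟨ cong (λ k → suc k * w) (transpose-other {i} {j} (≢pred i<nw) (≢pred j<nw)) ⟩
    suc (pred nw) * w          ≡⟨ cong (_* w) (suc-pred nw) ⟩
    nw * w                     ≡⟨ N≡ ⟨
    N                          ∎
    where
    open ≡-Reasoning
    instance
      nw≢0 : NonZero nw
      nw≢0 = >-nonZero (≤-<-trans z≤n i<nw)
    ≢pred : ∀ {k} → suc k < nw → pred nw ≢ k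
    ≢pred sk<nw refl = <-irrefl (suc-pred nw) sk<nw

  τʳ-% : ∀ {b} → 0 < b → τʳ b % w ≡ b % w
  τʳ-% {suc x} _ = begin
    (1 + τ x) % w                  ≡⟨ %-distribˡ-+ 1 (τ x) w ⟩
    (1 % w + τ x % w) % w          ≡⟨ cong (λ r → (1 % w + r) % w) (τ-% x) ⟩
    (1 % w + x % w) % w            ≡⟨ %-distribˡ-+ 1 x w ⟨
    suc x % w                      ∎
    where open ≡-Reasoning

  τ-∣ : ∀ {a} → w ∣ a → w ∣ τ a
  τ-∣ {a} = %≡⇒∣ ∣-refl (sym (τ-% a))

  τ-∣⁻ : ∀ {a} → w ∣ τ a → w ∣ a
  τ-∣⁻ {a} = %≡⇒∣ ∣-refl (τ-% a)

  τʳ-∣ : ∀ {b} → 0 < b → w ∣ b → w ∣ τʳ b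
  τʳ-∣ 0<b = %≡⇒∣ ∣-refl (sym (τʳ-% 0<b))

  τʳ-∣⁻ : ∀ {b} → 0 < b → w ∣ τʳ b → w ∣ b
  τʳ-∣⁻ 0<b = %≡⇒∣ ∣-refl (τʳ-% 0<b)

  τ-0< : ∀ {a} → 0 < a → 0 < τ a
  τ-0< {a} 0<a = n≢0⇒n>0 (λ τa≡0 → <-irrefl (sym (τ-injective {a} {0} (trans τa≡0 (sym τ-0)))) 0<a)

  τ-unmoved-left : ∀ {a} → w ∣ a → ¬ Break a → τ a ≡ a
  τ-unmoved-left (divides-refl q) ¬brk = trans (τ-* q) (cong (_* w)
    (transpose-other {i} {j} {q} (λ { refl → ¬brk break-i }) (λ { refl → ¬brk break-j })))

  τʳ-unmoved-right : ∀ {b} → 0 < b → w ∣ b → ¬ Break b → τʳ b ≡ b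
  τʳ-unmoved-right _ (divides-refl (suc q)) ¬brk = trans (τʳ-* q) (cong (λ k → suc k * w)
    (transpose-other {i} {j} {q} (λ { refl → ¬brk break-i′ }) (λ { refl → ¬brk break-j′ })))

  lower : ∀ {x y} → ¬ w ∣ x → w ∣ y → 0 < y → level x < level y
  lower {x} {y} w∤x w∣y 0<y =
    ∤∣⇒level< (suc t) 0<y (w∤x ∘ subst (_∣ x) (sym w≡)) (subst (_∣ y) w≡ w∣y)

  -- An end that is no multiple of `w` keeps its level. If exactly one end is a multiple of `w`, it
  -- has the higher level before and after. If both are, safety says that neither is a break, so
  -- neither moves.
  level<-invariant : ∀ {a b} → Safe a b → 0 < a →
    (level (τʳ b) <ᵇ level (τ a)) ≡ (level b <ᵇ level a)
  level<-invariant {a} {b} s 0<a with w ∣? a | w ∣? b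
  ... | no w∤a | no w∤b = cong₂ _<ᵇ_ (%≡⇒level≡ {w} {suc t} w≡ (τʳ-% 0<b) (λ w∣ → w∤b (τʳ-∣⁻ 0<b w∣)))
                                      (%≡⇒level≡ {w} {suc t} w≡ (τ-% a) (λ w∣ → w∤a (τ-∣⁻ w∣)))
    where 0<b = <-trans 0<a (a<b s)
  ... | no w∤a | yes w∣b = does-⇔ (mk⇔ (λ lt → contradiction lt (<-asym (lower (w∤a ∘ τ-∣⁻) (τʳ-∣ 0<b w∣b) (s≤s z≤n))))
                                        (λ lt → contradiction lt (<-asym (lower w∤a w∣b 0<b))))
                                   (level (τʳ b) <? level (τ a)) (level b <? level a)
    where 0<b = <-trans 0<a (a<b s)
  ... | yes w∣a | no w∤b = does-⇔ (mk⇔ (λ _ → lower w∤b w∣a 0<a)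
                                        (λ _ → lower (w∤b ∘ τʳ-∣⁻ 0<b) (τ-∣ w∣a) (τ-0< 0<a)))
                                   (level (τʳ b) <? level (τ a)) (level b <? level a)
    where 0<b = <-trans 0<a (a<b s)
  ... | yes w∣a | yes w∣b = cong₂ (λ b a → level b <ᵇ level a)
                              (τʳ-unmoved-right (<-trans 0<a (a<b s)) w∣b (safe-right s w∣a))
                              (τ-unmoved-left w∣a (safe-left s w∣b))

  -- Every test of the guide keeps its outcome: equality with 0, `N` or a known point by
  -- injectivity, where known points are interior and thus images under both maps, and the
  -- comparison of levels by `level<-invariant`.
  guide-τ : ∀ {K a b} → Safe a b → All Interior K →
    guide N (map τ K) (τ a) (τʳ b) ≡ map τ (guide N K a b)
  guide-τ {K} {a} {b} s ints = trans
    (guideBy-cong (does-⇔ (mk⇔ (λ e → τ-injective (trans e (sym τ-0))) (λ { refl → τ-0 })) (τ a ≟ 0) (a ≟ 0))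
           (does-⇔ (mk⇔ (λ e → τʳ-injective 0<b 0<N (trans e (sym τʳ-N))) (λ { refl → τʳ-N })) (τʳ b ≟ N) (b ≟ N))
           (elemℕ-map τ τ {x = a} (λ _ → τ-injective) (λ { _ refl → refl }) ints)
           (elemℕ-map τʳ τ {x = b} (λ { (0<y , ¬brk) e → τʳ-injective 0<b 0<y (trans e (¬Break⇒τ≡τʳ 0<y ¬brk)) })
                                   (λ { (0<y , ¬brk) refl → sym (¬Break⇒τ≡τʳ 0<y ¬brk) }) ints))
    (guideBy-map τ τʳ (λ { (0<y , ¬brk) → ¬Break⇒τ≡τʳ 0<y ¬brk }) (a ≡ᵇ 0) (b ≡ᵇ N) (elemℕ a K) (elemℕ b K) (level b <ᵇ level a) (level (τʳ b) <ᵇ level (τ a))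
      (guide-interior K s) (λ a≢0 _ → level<-invariant s (n≢0⇒n>0 (λ { refl → case-false a≢0 }))))
    where
    0<b = ≤-<-trans z≤n (a<b s)
    0<N : 0 < N
    0<N = subst (0 <_) (sym N≡) (≤-trans (≤-<-trans z≤n m<w) (m≤n*m w nw {{>-nonZero (≤-<-trans z≤n i<nw)}}))
    case-false : true ≡ false → ⊥
    case-false ()
    guideBy-cong : ∀ {z z′ n n′ ea ea′ eb eb′ l a b} → z′ ≡ z → n′ ≡ n → ea′ ≡ ea → eb′ ≡ eb →
      guideBy z′ n′ ea′ eb′ l a b ≡ guideBy z n ea eb l a b
    guideBy-cong refl refl refl refl = refl

  -- A safe interval has no break strictly inside, so no adjacency within it is lost and the
  -- exchange translates it as a whole.
  safe⇒rigid : ∀ {a b} → Safe a b → ∀ d → a + d < b → τ (a + d) ≡ τ a + d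
  safe⇒rigid {a} s zero    _   = trans (cong τ (+-identityʳ a)) (sym (+-identityʳ (τ a)))
  safe⇒rigid {a} {b} s (suc d) lt = begin
    τ (a + suc d)        ≡⟨ cong τ (+-suc a d) ⟩
    τ (suc (a + d))      ≡⟨ τ-suc (a + d) ¬brk ⟩
    suc (τ (a + d))      ≡⟨ cong suc (safe⇒rigid s d (<-trans (n<1+n _) lt′)) ⟩
    suc (τ a + d)        ≡⟨ +-suc (τ a) d ⟨
    τ a + suc d          ∎
    where
    open ≡-Reasoning
    lt′ : suc (a + d) < b
    lt′ = subst (_< b) (+-suc a d) lt
    ¬brk : ¬ Break (suc (a + d))
    ¬brk brk with uncrossed s brk at
    ... | inj₁ b≤ = <-irrefl refl (<-≤-trans lt′ b≤)
    ... | inj₂ ≤a = <-irrefl refl (<-≤-trans (s≤s (m≤m+n a d)) ≤a)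

  module _ {a b : ℕ} (s : Safe a b) where

    safe⇒τ : ∀ {x} → a ≤ x → x < b → τ x ≡ τ a + (x ∸ a)
    safe⇒τ {x} a≤x x<b = trans (cong τ (sym a+[x∸a]≡x)) (safe⇒rigid s (x ∸ a) (subst (_< b) (sym a+[x∸a]≡x) x<b))
      where a+[x∸a]≡x = m+[n∸m]≡n a≤x

    τ-mono : ∀ {x y} → a ≤ x → x ≤ y → y < b → τ x ≤ τ y
    τ-mono {x} {y} a≤x x≤y y<b = subst₂ _≤_ (sym (safe⇒τ a≤x (≤-<-trans x≤y y<b))) (sym (safe⇒τ (≤-trans a≤x x≤y) y<b))
      (+-monoʳ-≤ (τ a) (∸-monoˡ-≤ a x≤y))

    -- Carries over the condition that two atoms intersect: `x` is the last unit interval of one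
    -- atom and `y` the first of the other, both inside their union.
    τ-≤-suc : ∀ {x y} → a ≤ x → a ≤ y → x < b → y < b → y ≤ suc x → τ y ≤ suc (τ x)
    τ-≤-suc {x} {y} a≤x a≤y x<b y<b y≤sx = subst₂ (λ u v → u ≤ suc v) (sym (safe⇒τ a≤y y<b)) (sym (safe⇒τ a≤x x<b)) (begin
      τ a + (y ∸ a)           ≤⟨ +-monoʳ-≤ (τ a) (∸-monoˡ-≤ a y≤sx) ⟩
      τ a + (suc x ∸ a)       ≡⟨ cong (τ a +_) (+-∸-assoc 1 a≤x) ⟩
      τ a + suc (x ∸ a)       ≡⟨ +-suc (τ a) (x ∸ a) ⟩
      suc (τ a + (x ∸ a))     ∎)
      where open ≤-Reasoning

    τ-⊓ : ∀ {x y} → a ≤ x → a ≤ y → x < b → y < b → τ (x ⊓ y) ≡ τ x ⊓ τ y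
    τ-⊓ {x} {y} a≤x a≤y x<b y<b with ≤-total x y
    ... | inj₁ x≤y = trans (cong τ (m≤n⇒m⊓n≡m x≤y)) (sym (m≤n⇒m⊓n≡m (τ-mono a≤x x≤y y<b)))
    ... | inj₂ y≤x = trans (cong τ (m≥n⇒m⊓n≡n y≤x)) (sym (m≥n⇒m⊓n≡n (τ-mono a≤y y≤x x<b)))

    τʳ-⊔ : ∀ {x y} → a < x → a < y → x ≤ b → y ≤ b → τʳ (x ⊔ y) ≡ τʳ x ⊔ τʳ y
    τʳ-⊔ {suc x} {suc y} (s≤s a≤x) (s≤s a≤y) x<b y<b with ≤-total x y
    ... | inj₁ x≤y = cong suc (trans (cong τ (m≤n⇒m⊔n≡n x≤y)) (sym (m≤n⇒m⊔n≡n (τ-mono a≤x x≤y y<b))))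
    ... | inj₂ y≤x = cong suc (trans (cong τ (m≥n⇒m⊔n≡m y≤x)) (sym (m≥n⇒m⊔n≡m (τ-mono a≤y y≤x x<b))))

-- Rounds

module Dynamics (P M : ℕ) (s : Strategy P M) where

  open Strategy s

  Mem : Set
  Mem = List (Cell P M)

  -- The second component lists the points revealed to the processor in the current round.
  Local : Set
  Local = Mem × List ℕ

  -- The first component lists the points revealed before the round.
  State : Set
  State = List ℕ × Vec Mem P

  module _ (π : Perm P M) (r : ℕ) (K : List ℕ) (p : Fin P) where

    view : Local → View P M
    view (mem , ks) = record
      { rnd    = r
      ; self   = p
      ; memory = map proj₁ mem
      ; known  = mapMaybe (pairOf P M π s) (K ++ ks) }

    -- During a round a view depends only on the processor's own memory and revelations and on data
    -- fixed at the beginning, so the interleaved steps separate into one run per processor.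
    data LStep : Local → Local → Set where
      copy : ∀ {mem ks k x} → local (view (mem , ks)) ≡ copy k →
             nth mem k ≡ just x →
             LStep (mem , ks) (mem ++ x ∷ [] , ks)
      delete : ∀ {mem ks k x} → local (view (mem , ks)) ≡ delete k →
             nth mem k ≡ just x →
             LStep (mem , ks) (removeAt mem k , ks)
      fuse : ∀ {mem ks k l x y a b a′ b′} → local (view (mem , ks)) ≡ fuseOp k l →
             nth mem k ≡ just (x , a , b) →
             nth mem l ≡ just (y , a′ , b′) →
             a′ ≤ b → a ≤ b′ →
             LStep (mem , ks)
               ( removeAt (removeAt mem (k ⊔ l)) (k ⊓ l) ++ (fuse x y , a ⊓ a′ , b ⊔ b′) ∷ []
               , ks ++ guide (P * M) (K ++ ks) (a ⊓ a′) (b ⊔ b′))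

    sent : Local → Fin P → Mem
    sent e q = mapMaybe
      (λ d → if does (proj₂ d Fin.≟ q) then nth (proj₁ e) (proj₁ d) else nothing)
      (comm (view e))

    LStep-deterministic : ∀ {e f f′} → LStep e f → LStep e f′ → f ≡ f′
    LStep-deterministic (copy o n) (copy o′ n′) with trans (sym o) o′
    ... | refl with trans (sym n) n′
    ...   | refl = refl
    LStep-deterministic (copy o n) (delete o′ n′) with trans (sym o) o′
    ... | ()
    LStep-deterministic (copy o n) (fuse o′ n′ m′ u v) with trans (sym o) o′
    ... | ()
    LStep-deterministic (delete o n) (copy o′ n′) with trans (sym o) o′
    ... | ()
    LStep-deterministic (delete o n) (delete o′ n′) with trans (sym o) o′
    ... | refl = refl
    LStep-deterministic (delete o n) (fuse o′ n′ m′ u v) with trans (sym o) o′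
    ... | ()
    LStep-deterministic (fuse o n m u v) (copy o′ n′) with trans (sym o) o′
    ... | ()
    LStep-deterministic (fuse o n m u v) (delete o′ n′) with trans (sym o) o′
    ... | ()
    LStep-deterministic (fuse o n m u v) (fuse o′ n′ m′ u′ v′) with trans (sym o) o′
    ... | refl with trans (sym n) n′ | trans (sym m) m′
    ...   | refl | refl = refl

    done-stuck : ∀ {e f} → local (view e) ≡ done → ¬ LStep e f
    done-stuck d (copy o _) with trans (sym d) o
    ... | ()
    done-stuck d (delete o _) with trans (sym d) o
    ... | ()
    done-stuck d (fuse o _ _ _ _) with trans (sym d) o
    ... | ()

    run-unique : ∀ {e f f′} → Star LStep e f → local (view f) ≡ done →
                 Star LStep e f′ → local (view f′) ≡ done → f ≡ f′
    run-unique ε        d ε          d′ = refl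
    run-unique ε        d (x ◅ xs)   d′ = contradiction x (done-stuck d)
    run-unique (x ◅ xs) d ε          d′ = contradiction x (done-stuck d′)
    run-unique (x ◅ xs) d (x′ ◅ xs′) d′ with LStep-deterministic x x′
    ... | refl = run-unique xs d xs′ d′

  module _ (π : Perm P M) where

    -- Memories are tabulated into a vector so that states with pointwise equal memories are equal.
    nextState : ℕ → List ℕ → (Fin P → Local) → State
    nextState r K end = K ++ concatMap (proj₂ ∘ end) (allFin P)
                  , tabulate (λ q → concatMap (λ p → sent π r K p (end p) q) (allFin P))

    record Round (r : ℕ) (S S′ : State) : Set where
      field
        end      : Fin P → Local
        runs     : ∀ p → Star (LStep π r (proj₁ S) p) (lookup (proj₂ S) p , []) (end p)
        finished : ∀ p → local (view π r (proj₁ S) p (end p)) ≡ done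
        memBd    : ∀ q → length (lookup (proj₂ S′) q) ≤ M
        result   : S′ ≡ nextState r (proj₁ S) end

    initial : State
    initial = K (init P M π s) , tabulate (initMem P M π s)

    -- The states at the beginnings of the rounds so far, the latest first.
    data History : List State → Set where
      start : History (initial ∷ [])
      round : ∀ {S S′ Ss} → History (S ∷ Ss) → Round (length Ss) S S′ → History (S′ ∷ S ∷ Ss)

    nextState-cong : ∀ r K {end end′} → (∀ p → end p ≡ end′ p) → nextState r K end ≡ nextState r K end′
    nextState-cong r K eq = cong₂ _,_
      (cong (K ++_) (concatMap-cong (λ p → cong proj₂ (eq p)) (allFin P)))
      (tabulate-cong (λ q → concatMap-cong (λ p → cong (λ e → sent π r K p e q) (eq p)) (allFin P)))

    Round-unique : ∀ {r S S′ S″} → Round r S S′ → Round r S S″ → S′ ≡ S″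
    Round-unique {r} {S} R R′ = trans (result R) (trans
      (nextState-cong r (proj₁ S) (λ p → run-unique π r (proj₁ S) p (runs R p) (finished R p) (runs R′ p) (finished R′ p)))
      (sym (result R′)))
      where open Round

    -- The strategy is deterministic, and so are the guide and the exchange of data. This identifies
    -- the history of a solving run with the one constructed by exchanges, as far as both reach.
    History-unique : ∀ {Ss Ts} → History Ss → History Ts → length Ss ≡ length Ts → Ss ≡ Ts
    History-unique start       start       _  = refl
    History-unique start       (round _ _) ()
    History-unique (round _ _) start       ()
    History-unique (round H R) (round H′ R′) eq with History-unique H H′ (suc-injective eq)
    ... | refl = cong (_∷ _) (Round-unique R R′)

    -- The invariant by which a sequence of interleaved global steps is read as a history followed
    -- by an unfinished round.
    record MidRound (c : Config P M) : Set where
      field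
        {past}   : List State
        {now}    : State
        history  : History (now ∷ past)
        rnd≡     : rnd c ≡ length past
        K≡       : K c ≡ proj₁ now
        runs     : ∀ p → Star (LStep π (rnd c) (K c) p) (lookup (proj₂ now) p , []) (mems c p , locK c p)
        finished : ∀ p → fin c p ≡ true → local (viewOf P M π s c p) ≡ done

    MidRound-init : MidRound (init P M π s)
    MidRound-init = record
      { history  = start
      ; rnd≡     = refl
      ; K≡       = refl
      ; runs     = λ p → subst (λ m → Star (LStep π 0 (proj₁ initial) p) (m , []) (initMem P M π s p , []))
                     (sym (lookup∘tabulate (initMem P M π s) p)) ε
      ; finished = λ p () }

    MidRound-step : ∀ {c d} → Step P M π s c d → MidRound c → MidRound d
    MidRound-step (sCopy {c} {p} nf o n _) I = record
      { history = history ; rnd≡ = rnd≡ ; K≡ = K≡ ; runs = runs′ ; finished = finished′ }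
      where
      open MidRound I
      d = record c { mems = upd P M (mems c) p (mems c p ++ _ ∷ []) }
      runs′ : ∀ q → Star (LStep π (rnd d) (K d) q) (lookup (proj₂ now) q , []) (mems d q , locK d q)
      runs′ q with q Fin.≟ p
      ... | yes refl = runs q ◅◅ copy o n ◅ ε
      ... | no _     = runs q
      finished′ : ∀ q → fin d q ≡ true → local (view π (rnd c) (K c) q (mems d q , locK d q)) ≡ done
      finished′ q f with q Fin.≟ p
      ... | yes refl = contradiction (trans (sym f) nf) λ()
      ... | no _     = finished q f
    MidRound-step (sDelete {c} {p} {k} nf o n) I = record
      { history = history ; rnd≡ = rnd≡ ; K≡ = K≡ ; runs = runs′ ; finished = finished′ }
      where
      open MidRound I
      d = record c { mems = upd P M (mems c) p (removeAt (mems c p) k) }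
      runs′ : ∀ q → Star (LStep π (rnd d) (K d) q) (lookup (proj₂ now) q , []) (mems d q , locK d q)
      runs′ q with q Fin.≟ p
      ... | yes refl = runs q ◅◅ delete o n ◅ ε
      ... | no _     = runs q
      finished′ : ∀ q → fin d q ≡ true → local (view π (rnd c) (K c) q (mems d q , locK d q)) ≡ done
      finished′ q f with q Fin.≟ p
      ... | yes refl = contradiction (trans (sym f) nf) λ()
      ... | no _     = finished q f
    MidRound-step (sFuse {c} {p} nf o k≢l n n′ u v) I = record
      { history = history ; rnd≡ = rnd≡ ; K≡ = K≡ ; runs = runs′ ; finished = finished′ }
      where
      open MidRound I
      d = record c { mems = upd P M (mems c) p _ ; locK = upd P M (locK c) p _ }
      runs′ : ∀ q → Star (LStep π (rnd c) (K c) q) (lookup (proj₂ now) q , []) (mems d q , locK d q)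
      runs′ q with q Fin.≟ p
      ... | yes refl = runs q ◅◅ fuse o n n′ u v ◅ ε
      ... | no _     = runs q
      finished′ : ∀ q → fin c q ≡ true → local (view π (rnd c) (K c) q (mems d q , locK d q)) ≡ done
      finished′ q f with q Fin.≟ p
      ... | yes refl = contradiction (trans (sym f) nf) λ()
      ... | no _     = finished q f
    MidRound-step (sDone {c} {p} nf o) I = record
      { history = history ; rnd≡ = rnd≡ ; K≡ = K≡ ; runs = runs ; finished = finished′ }
      where
      open MidRound I
      finished′ : ∀ q → upd P M (fin c) p true q ≡ true → local (viewOf P M π s c q) ≡ done
      finished′ q f with q Fin.≟ p
      ... | yes refl = o
      ... | no _     = finished q f
    MidRound-step (sComm {c} allFinished ok) I with MidRound.rnd≡ I | MidRound.K≡ I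
    ... | refl | refl = record
      { history  = round history record
          { end      = λ p → mems c p , locK c p
          ; runs     = runs
          ; finished = λ p → finished p (allFinished p)
          ; memBd    = λ q → subst (λ m → length m ≤ M) (sym (lookup∘tabulate (newMem P M π s c) q)) (memBd q)
          ; result   = refl }
      ; rnd≡     = refl
      ; K≡       = refl
      ; runs     = λ p → subst (λ m → Star (LStep π _ _ p) (m , []) (newMem P M π s c p , []))
                     (sym (lookup∘tabulate (newMem P M π s c) p)) ε
      ; finished = λ p () }
      where
      open MidRound I
      open CommOK ok

    MidRound-star : ∀ {c d} → Star (Step P M π s) c d → MidRound c → MidRound d
    MidRound-star ε        I = I
    MidRound-star (x ◅ xs) I = MidRound-star xs (MidRound-step x I)

-- Crossing a point requires a contact

nth-∈ : ∀ {A : Set} (xs : List A) k {x} → nth xs k ≡ just x → x ∈ xs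
nth-∈ (x ∷ xs) zero    refl = here refl
nth-∈ (x ∷ xs) (suc k) eq   = there (nth-∈ xs k eq)

nth-All : ∀ {A : Set} {Q : A → Set} {xs : List A} → All Q xs → ∀ k → MaybeAll.All Q (nth xs k)
nth-All []       k       = MaybeAll.nothing
nth-All (q ∷ qs) zero    = MaybeAll.just q
nth-All (q ∷ qs) (suc k) = nth-All qs k

removeAt-All : ∀ {A : Set} {Q : A → Set} {xs : List A} → All Q xs → ∀ k → All Q (removeAt xs k)
removeAt-All []       k       = []
removeAt-All (q ∷ qs) zero    = qs
removeAt-All (q ∷ qs) (suc k) = q ∷ removeAt-All qs k

nth-map : ∀ {A B : Set} (f : A → B) xs k → nth (map f xs) k ≡ Maybe.map f (nth xs k)
nth-map f []       k       = refl
nth-map f (x ∷ xs) zero    = refl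
nth-map f (x ∷ xs) (suc k) = nth-map f xs k

removeAt-map : ∀ {A B : Set} (f : A → B) xs k → removeAt (map f xs) k ≡ map f (removeAt xs k)
removeAt-map f []       k       = refl
removeAt-map f (x ∷ xs) zero    = refl
removeAt-map f (x ∷ xs) (suc k) = cong (f x ∷_) (removeAt-map f xs k)

concatMap-All : ∀ {A B : Set} {Q : B → Set} (f : A → List B) xs → (∀ x → All Q (f x)) → All Q (concatMap f xs)
concatMap-All f []       qs = []
concatMap-All f (x ∷ xs) qs = All.++⁺ (qs x) (concatMap-All f xs qs)

FuseClosed : (ℕ → ℕ → Set) → Set
FuseClosed Φ = ∀ {a b a′ b′} → Φ a b → Φ a′ b′ → a′ ≤ b → a ≤ b′ → Φ (a ⊓ a′) (b ⊔ b′)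

-- Intervals not crossing z fuse into an interval crossing z only if one of them ends at z and
-- another one starts there; each of the next two conditions excludes one of the two.
NoneEnds NoneStarts : ℕ → ℕ → ℕ → Set
NoneEnds   z a b = b < z ⊎ z ≤ a
NoneStarts z a b = b ≤ z ⊎ z < a

noneEnds-closed : ∀ {z} → FuseClosed (NoneEnds z)
noneEnds-closed (inj₁ b<z) (inj₁ b′<z) _ _ = inj₁ (⊔-lub b<z b′<z)
noneEnds-closed (inj₁ b<z) (inj₂ z≤a′) a′≤b _ = contradiction (≤-trans z≤a′ a′≤b) (<⇒≱ b<z)
noneEnds-closed (inj₂ z≤a) (inj₁ b′<z) _ a≤b′ = contradiction (≤-trans z≤a a≤b′) (<⇒≱ b′<z)
noneEnds-closed (inj₂ z≤a) (inj₂ z≤a′) _ _ = inj₂ (⊓-glb z≤a z≤a′)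

noneStarts-closed : ∀ {z} → FuseClosed (NoneStarts z)
noneStarts-closed (inj₁ b≤z) (inj₁ b′≤z) _ _ = inj₁ (⊔-lub b≤z b′≤z)
noneStarts-closed (inj₁ b≤z) (inj₂ z<a′) a′≤b _ = contradiction (≤-trans a′≤b b≤z) (<⇒≱ z<a′)
noneStarts-closed (inj₂ z<a) (inj₁ b′≤z) _ a≤b′ = contradiction (≤-trans a≤b′ b′≤z) (<⇒≱ z<a)
noneStarts-closed (inj₂ z<a) (inj₂ z<a′) _ _ = inj₂ (⊓-glb z<a z<a′)

<-closed : FuseClosed _<_
<-closed {a} {b} {a′} {b′} a<b _ _ _ = ≤-<-trans (m⊓n≤m a a′) (<-≤-trans a<b (m≤m⊔n b b′))

module Invariants (P M : ℕ) (s : Strategy P M) where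

  open Dynamics P M s public

  AllIv : (ℕ → ℕ → Set) → Mem → Set
  AllIv Φ = All (λ x → Φ (lo P M x) (hi P M x))

  module _ {π : Perm P M} {r : ℕ} {K : List ℕ} {p : Fin P} where

    LStep-All : ∀ {Φ} → FuseClosed Φ → ∀ {e f} → LStep π r K p e f → AllIv Φ (proj₁ e) → AllIv Φ (proj₁ f)
    LStep-All cl (copy {mem} {k = k} _ n) φs = All.++⁺ φs (All.lookup φs (nth-∈ mem k n) ∷ [])
    LStep-All cl (delete {k = k} _ _) φs = removeAt-All φs k
    LStep-All cl (fuse {mem} {k = k} {l} _ n n′ u v) φs =
      All.++⁺ (removeAt-All (removeAt-All φs (k ⊔ l)) (k ⊓ l))
              (cl (All.lookup φs (nth-∈ mem k n)) (All.lookup φs (nth-∈ mem l n′)) u v ∷ [])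

    run-All : ∀ {Φ} → FuseClosed Φ → ∀ {e f} → Star (LStep π r K p) e f → AllIv Φ (proj₁ e) → AllIv Φ (proj₁ f)
    run-All cl ε        φs = φs
    run-All {Φ} cl (x ◅ xs) φs = run-All {Φ} cl xs (LStep-All {Φ} cl x φs)

  sent-All : ∀ {π r K p Φ} e q → AllIv Φ (proj₁ e) → AllIv Φ (sent π r K p e q)
  sent-All {π} {r} {K} {p} {Φ} e q φs = All.mapMaybe⁺ {f = f} (All.map⁺ (All.universal g (Strategy.comm s (view π r K p e))))
    where
    f : ℕ × Fin P → Maybe (Cell P M)
    f d = if does (proj₂ d Fin.≟ q) then nth (proj₁ e) (proj₁ d) else nothing
    g : ∀ d → MaybeAll.All (λ x → Φ (lo P M x) (hi P M x)) (f d)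
    g d with does (proj₂ d Fin.≟ q)
    ... | true  = nth-All φs (proj₁ d)
    ... | false = MaybeAll.nothing

  memory : State → Fin P → Mem
  memory S = lookup (proj₂ S)

  endpoints : Mem → List (ℕ × ℕ)
  endpoints mem = cartesianProductWith (λ x y → hi P M x , lo P M y) mem mem

  -- The pairs (right endpoint, left endpoint) occurring in a common memory.
  contacts : State → List (ℕ × ℕ)
  contacts S = concatMap (endpoints ∘ memory S) (allFin P)

  contacts⁺ : ∀ S p {x y} → x ∈ memory S p → y ∈ memory S p → (hi P M x , lo P M y) ∈ contacts S
  contacts⁺ S p x∈ y∈ = ∈-concatMap⁺ (endpoints ∘ memory S)
    (lose (∈-allFin p) (∈-cartesianProductWith⁺ (λ x y → hi P M x , lo P M y) x∈ y∈))

  contacts⁻ : ∀ S {c} → c ∈ contacts S →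
    ∃ λ p → ∃ λ x → ∃ λ y → x ∈ memory S p × y ∈ memory S p × c ≡ (hi P M x , lo P M y)
  contacts⁻ S c∈ with find (∈-concatMap⁻ (endpoints ∘ memory S) {xs = allFin P} c∈)
  ... | p , _ , c∈p with ∈-cartesianProductWith⁻ (λ x y → hi P M x , lo P M y) (memory S p) (memory S p) c∈p
  ... | x , y , x∈ , y∈ , eq = p , x , y , x∈ , y∈ , eq

  -- The alternative is chosen once for the whole memory. Each of the two survives fusions, which
  -- merely not crossing `z` does not.
  Unfusable : ℕ → Mem → Set
  Unfusable z mem = AllIv (NoneEnds z) mem ⊎ AllIv (NoneStarts z) mem

  -- Either no atom in the memory ends at `z`, or one does, and then an atom starting at `z` would
  -- complete a contact.
  noContact⇒unfusable : ∀ {S p z} → (z , z) ∉ contacts S → AllIv (Uncrossed z) (memory S p) → Unfusable z (memory S p)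
  noContact⇒unfusable {S} {p} {z} z∉ us with any? (λ x → hi P M x ≟ z) (memory S p)
  ... | no none = inj₁ (All.map (λ { (inj₁ hi≤z , hi≢z) → inj₁ (≤∧≢⇒< hi≤z hi≢z) ; (inj₂ z≤lo , _) → inj₂ z≤lo })
                         (All.zip (us , All.¬Any⇒All¬ _ none)))
  ... | yes some with find some
  ...   | x , x∈ , refl = inj₂ (All.tabulate λ {y} y∈ → strict (All.lookup us y∈)
                                  (λ { refl → z∉ (contacts⁺ S p x∈ y∈) }))
    where
    strict : ∀ {a b} → Uncrossed z a b → a ≢ z → NoneStarts z a b
    strict (inj₁ b≤z) _   = inj₁ b≤z
    strict (inj₂ z≤a) a≢z = inj₂ (≤∧≢⇒< z≤a (a≢z ∘ sym))

  unfusable⇒uncrossed : ∀ {z mem} → Unfusable z mem → AllIv (Uncrossed z) mem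
  unfusable⇒uncrossed (inj₁ h) = All.map (λ { (inj₁ b<z) → inj₁ (<⇒≤ b<z) ; (inj₂ z≤a) → inj₂ z≤a }) h
  unfusable⇒uncrossed (inj₂ h) = All.map (λ { (inj₁ b≤z) → inj₁ b≤z ; (inj₂ z<a) → inj₂ (<⇒≤ z<a) }) h

  module _ {π : Perm P M} {r : ℕ} {K : List ℕ} {p : Fin P} where

    LStep-unfusable : ∀ {e f z} → LStep π r K p e f → Unfusable z (proj₁ e) → Unfusable z (proj₁ f)
    LStep-unfusable {z = z} x (inj₁ h) = inj₁ (LStep-All {Φ = NoneEnds z} noneEnds-closed x h)
    LStep-unfusable {z = z} x (inj₂ h) = inj₂ (LStep-All {Φ = NoneStarts z} noneStarts-closed x h)

    run-unfusable : ∀ {e f z} → Star (LStep π r K p) e f → Unfusable z (proj₁ e) → Unfusable z (proj₁ f)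
    run-unfusable ε        h = h
    run-unfusable {z = z} (x ◅ xs) h = run-unfusable {z = z} xs (LStep-unfusable {z = z} x h)

  module _ {π : Perm P M} where

    initMem-All : ∀ {Φ} → (∀ a → Φ a (suc a)) → ∀ p → AllIv Φ (initMem P M π s p)
    initMem-All φ p = All.map⁺ (All.universal (λ m → φ _) (allFin M))

    memory-initial : ∀ {Φ} → (∀ a → Φ a (suc a)) → ∀ p → AllIv Φ (memory (initial π) p)
    memory-initial {Φ} φ p = subst (AllIv Φ) (sym (lookup∘tabulate (initMem P M π s) p)) (initMem-All {Φ} φ p)

    Round-All : ∀ {Φ r S S′} (R : Round π r S S′) → (∀ p → AllIv Φ (proj₁ (Round.end R p))) → ∀ q → AllIv Φ (memory S′ q)
    Round-All {Φ} {r} {S} R φs q rewrite Round.result R =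
      subst (AllIv Φ) (sym (lookup∘tabulate _ q))
        (concatMap-All _ (allFin P) (λ p → sent-All {π} {r} {proj₁ S} {p} {Φ} (Round.end R p) q (φs p)))

    uncrossed-unit : ∀ z a → Uncrossed z a (suc a)
    uncrossed-unit z a with a <? z
    ... | yes a<z = inj₁ a<z
    ... | no a≮z  = inj₂ (≮⇒≥ a≮z)

    -- A round that begins without a contact at `z` keeps every memory unfusable there, and
    -- communication only redistributes atoms.
    history-uncrossed : ∀ {S Ss z} → History π (S ∷ Ss) → All (λ S′ → (z , z) ∉ contacts S′) Ss →
      ∀ p → AllIv (Uncrossed z) (memory S p)
    history-uncrossed {z = z} start [] = memory-initial {Uncrossed z} (uncrossed-unit z)
    history-uncrossed {z = z} (round {S} H R) (z∉ ∷ z∉s) = Round-All {Uncrossed z} R λ p →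
      unfusable⇒uncrossed {z} (run-unfusable {z = z} (Round.runs R p) (noContact⇒unfusable {S} {p} {z} z∉ (history-uncrossed H z∉s p)))

    history-memory-bound : ∀ {Ss} → History π Ss → All (λ S → ∀ p → length (memory S p) ≤ M) Ss
    history-memory-bound start = (λ p → ≤-reflexive (trans (cong length (lookup∘tabulate (initMem P M π s) p))
      (trans (length-map _ (allFin M)) (length-tabulate {n = M} (λ i → i))))) ∷ []
    history-memory-bound (round H R) = Round.memBd R ∷ history-memory-bound H

-- Transporting a history along an exchange

module _ {P M : ℕ} (π : Perm P M) (s : Strategy P M) {x : ℕ} where

  leafAt-yes : (x<N : x < P * M) → leafAt P M π s x ≡ just (Inverse.from π (fromℕ< x<N))
  leafAt-yes x<N with x <? P * M
  ... | yes _  = refl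
  ... | no x≮N = contradiction x<N x≮N

  leafAt-no : ¬ x < P * M → leafAt P M π s x ≡ nothing
  leafAt-no x≮N with x <? P * M
  ... | yes x<N = contradiction x<N x≮N
  ... | no _    = refl

pairOf-cong : ∀ {P M} (π π′ : Perm P M) (s : Strategy P M) {x x′} →
  leafAt P M π s x ≡ leafAt P M π′ s x′ → leafAt P M π s (suc x) ≡ leafAt P M π′ s (suc x′) →
  pairOf P M π s (suc x) ≡ pairOf P M π′ s (suc x′)
pairOf-cong {P} {M} π π′ s {x} {x′} eq eq′ rewrite eq | eq′ with leafAt P M π′ s x′ | leafAt P M π′ s (suc x′)
... | just _  | just _  = refl
... | just _  | nothing = refl
... | nothing | just _  = refl
... | nothing | nothing = refl

mapMaybe-map-All : ∀ {A B C : Set} {Q : A → Set} {f : B → Maybe C} {g : A → B} {h : A → Maybe C} {xs} →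
  (∀ {x} → Q x → f (g x) ≡ h x) → All Q xs → mapMaybe f (map g xs) ≡ mapMaybe h xs
mapMaybe-map-All eq []       = refl
mapMaybe-map-All {h = h} {x ∷ xs} eq (q ∷ qs) rewrite eq q with h x
... | just y  = cong (y ∷_) (mapMaybe-map-All eq qs)
... | nothing = mapMaybe-map-All eq qs

module Simulation (P M : ℕ) (s : Strategy P M)
  (t w : ℕ) (w≡ : w ≡ 2 ^ suc t) .{{_ : NonZero w}} (nw i j : ℕ) (PM≡ : P * M ≡ nw * w)
  (0<i : 0 < i) (0<j : 0 < j) (i<nw : suc i < nw) (j<nw : suc j < nw) where

  open Invariants P M s public
  open SwapGuide t w w≡ (P * M) nw i j PM≡ 0<i 0<j i<nw j<nw public

  Guarded : ℕ → Set
  Guarded z = ∃ λ c → Break c × Guard c z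

  τ-<N : ∀ {x} → x < P * M → τ x < P * M
  τ-<N {x} x<N = subst (τ x <_) (sym PM≡)
    (τ-< (<-trans (n<1+n i) i<nw) (<-trans (n<1+n j) j<nw) (subst (x <_) PM≡ x<N))

  τFin : Fin (P * M) → Fin (P * M)
  τFin x = fromℕ< (τ-<N (toℕ<n x))

  toℕ-τFin : ∀ x → toℕ (τFin x) ≡ τ (toℕ x)
  toℕ-τFin x = toℕ-fromℕ< _

  τFin-involutive : ∀ x → τFin (τFin x) ≡ x
  τFin-involutive x = toℕ-injective (begin
    toℕ (τFin (τFin x))   ≡⟨ toℕ-τFin (τFin x) ⟩
    τ (toℕ (τFin x))      ≡⟨ cong τ (toℕ-τFin x) ⟩
    τ (τ (toℕ x))         ≡⟨ τ-involutive (toℕ x) ⟩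
    toℕ x                 ∎)
    where open ≡-Reasoning

  swapPerm : Perm P M → Perm P M
  swapPerm π = ↔-trans π (mk↔ₛ′ τFin τFin τFin-involutive τFin-involutive)

  -- The fusion history, which is all that the strategy sees of an atom, is kept.
  moveCell : Cell P M → Cell P M
  moveCell (x , a , b) = x , τ a , τʳ b

  moveLocal : Local → Local
  moveLocal (mem , ks) = map moveCell mem , map τ ks

  moveState : State → State
  moveState (K , mems) = map τ K , Vec.map (map moveCell) mems

  memory-move : ∀ S p → memory (moveState S) p ≡ map moveCell (memory S p)
  memory-move S p = lookup-map p (map moveCell) (proj₂ S)

  module _ (π : Perm P M) where

    π′ : Perm P M
    π′ = swapPerm π

    swapPerm-from : ∀ {x} (x<N : x < P * M) (τx<N : τ x < P * M) →
      Inverse.from π′ (fromℕ< τx<N) ≡ Inverse.from π (fromℕ< x<N)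
    swapPerm-from {x} x<N τx<N = cong (Inverse.from π) (toℕ-injective (begin
      toℕ (τFin (fromℕ< τx<N))    ≡⟨ toℕ-τFin (fromℕ< τx<N) ⟩
      τ (toℕ (fromℕ< τx<N))       ≡⟨ cong τ (toℕ-fromℕ< τx<N) ⟩
      τ (τ x)                     ≡⟨ τ-involutive x ⟩
      x                           ≡⟨ toℕ-fromℕ< x<N ⟨
      toℕ (fromℕ< x<N)            ∎))
      where open ≡-Reasoning

    leafAt-τ : ∀ x → leafAt P M π′ s (τ x) ≡ leafAt P M π s x
    leafAt-τ x = by-cases (x <? P * M)
      where
      by-cases : Dec (x < P * M) → leafAt P M π′ s (τ x) ≡ leafAt P M π s x
      by-cases (yes x<N) = trans (leafAt-yes π′ s (τ-<N x<N))
                                 (trans (cong just (swapPerm-from x<N (τ-<N x<N))) (sym (leafAt-yes π s x<N)))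
      by-cases (no x≮N)  = trans (leafAt-no π′ s (λ τx<N → x≮N (subst (_< P * M) (τ-involutive x) (τ-<N τx<N))))
                                 (sym (leafAt-no π s x≮N))

    -- The two leaves that meet at an interior point move together, so the strategy is told the same
    -- pair. With `moveCell` this makes the views before and after the exchange equal.
    pairOf-τ : ∀ {c} → Interior c → pairOf P M π′ s (τ c) ≡ pairOf P M π s c
    pairOf-τ {suc x} (_ , ¬brk) = trans (cong (pairOf P M π′ s) (τ-suc x ¬brk))
      (pairOf-cong π′ π s (leafAt-τ x) (trans (cong (leafAt P M π′ s) (sym (τ-suc x ¬brk))) (leafAt-τ (suc x))))

    mapMaybe-pairOf-τ : ∀ {ks} → All Interior ks → mapMaybe (pairOf P M π′ s) (map τ ks) ≡ mapMaybe (pairOf P M π s) ks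
    mapMaybe-pairOf-τ = mapMaybe-map-All pairOf-τ

    view-move : ∀ {r K p} e → All Interior (K ++ proj₂ e) →
      view π′ r (map τ K) p (moveLocal e) ≡ view π r K p e
    view-move {r} {K} {p} (mem , ks) ints = cong₂ (λ m k → record { rnd = r ; self = p ; memory = m ; known = k })
      (sym (map-∘ mem))
      (trans (cong (mapMaybe (pairOf P M π′ s)) (sym (map-++ τ K ks))) (mapMaybe-pairOf-τ ints))

    record Tame (K : List ℕ) (e : Local) : Set where
      field
        interior  : All Interior (K ++ proj₂ e)
        proper    : AllIv _<_ (proj₁ e)
        unfusable : ∀ {z} → Guarded z → Unfusable z (proj₁ e)

    open Tame

    safe-cell : ∀ {mem x} → AllIv _<_ mem → (∀ {z} → Guarded z → Unfusable z mem) → x ∈ mem → Safe (lo P M x) (hi P M x)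
    safe-cell proper unfusable x∈ = safe (All.lookup proper x∈)
      (λ {_} {z} brk g → All.lookup (unfusable⇒uncrossed {z} (unfusable (_ , brk , g))) x∈)

    LStep-proper : ∀ {r K p e f} → LStep π r K p e f → Tame K e → AllIv _<_ (proj₁ f)
    LStep-proper x T = LStep-All {Φ = _<_} <-closed x (proper T)

    LStep-tame : ∀ {r K p e f} → LStep π r K p e f → Tame K e → All Interior (K ++ proj₂ f) → Tame K f
    LStep-tame {f = f} x T ints = record
      { interior  = ints
      ; proper    = LStep-proper x T
      ; unfusable = λ {z} g → LStep-unfusable {z = z} x (unfusable T g) }

    local-move : ∀ {r K p o} e → Tame K e → Strategy.local s (view π r K p e) ≡ o →
      Strategy.local s (view π′ r (map τ K) p (moveLocal e)) ≡ o
    local-move {r} {K} {p} e T = trans (cong (Strategy.local s) (view-move {r} {K} {p} e (interior T)))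

    nth-move : ∀ mem {k y} → nth mem k ≡ just y → nth (map moveCell mem) k ≡ just (moveCell y)
    nth-move mem {k} n = trans (nth-map moveCell mem k) (cong (Maybe.map moveCell) n)

    moveLStep : ∀ {r K p e f} → LStep π r K p e f → Tame K e →
      LStep π′ r (map τ K) p (moveLocal e) (moveLocal f) × Tame K f
    moveLStep {r} {K} {p} x@(copy {mem} {ks} {k} {y} o n) T =
      subst (λ m → LStep π′ r (map τ K) p (moveLocal (mem , ks)) (m , map τ ks)) (sym (map-++ moveCell mem (y ∷ [])))
        (copy (local-move (mem , ks) T o) (nth-move mem n))
      , LStep-tame x T (interior T)
    moveLStep {r} {K} {p} x@(delete {mem} {ks} {k} o n) T =
      subst (λ m → LStep π′ r (map τ K) p (moveLocal (mem , ks)) (m , map τ ks)) (removeAt-map moveCell mem k)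
        (delete (local-move (mem , ks) T o) (nth-move mem n))
      , LStep-tame x T (interior T)
    moveLStep {r} {K} {p} step@(fuse {mem} {ks} {k} {l} {x} {y} {a} {b} {a′} {b′} o n n′ a′≤b a≤b′) T =
        subst (LStep π′ r (map τ K) p (moveLocal (mem , ks))) (cong₂ _,_ mem≡ ks≡)
          (fuse (local-move (mem , ks) T o) (nth-move mem n) (nth-move mem n′) τa′≤τb τa≤τb′)
        , LStep-tame step T (subst (All Interior) (++-assoc K ks _) (All.++⁺ (interior T) (guide-interior (K ++ ks) safe⊔)))
        where
        rest = removeAt (removeAt mem (k ⊔ l)) (k ⊓ l)
        -- The union is safe as well, because the step itself preserves `Unfusable` at guarded
        -- points. Hence one translation moves both parts, and minima, maxima and the intersection
        -- test are preserved.
        safe⊔ : Safe (a ⊓ a′) (b ⊔ b′)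
        safe⊔ = safe-cell (LStep-proper step T) (λ {z} g → LStep-unfusable {z = z} step (unfusable T g)) (∈-++⁺ʳ rest (here refl))
        a<b : a < b
        a<b = All.lookup (proper T) (nth-∈ mem k n)
        a′<b′ : a′ < b′
        a′<b′ = All.lookup (proper T) (nth-∈ mem l n′)
        pred-< : ∀ {x y z} → x < y → y ≤ z → pred y < z
        pred-< (s≤s _) y≤z = y≤z
        ≤-suc-pred : ∀ {x y z} → x < y → z ≤ y → z ≤ suc (pred y)
        ≤-suc-pred (s≤s _) z≤y = z≤y
        ≤-pred′ : ∀ {x y z} → x < y → z ≤ x → z ≤ pred y
        ≤-pred′ (s≤s x≤y) z≤x = ≤-trans z≤x x≤y
        τa′≤τb : τ a′ ≤ τʳ b
        τa′≤τb = τ-≤-suc safe⊔ (≤-pred′ a<b (m⊓n≤m a a′)) (m⊓n≤n a a′)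
          (pred-< a<b (m≤m⊔n b b′)) (<-≤-trans a′<b′ (m≤n⊔m b b′)) (≤-suc-pred a<b a′≤b)
        τa≤τb′ : τ a ≤ τʳ b′
        τa≤τb′ = τ-≤-suc safe⊔ (≤-pred′ a′<b′ (m⊓n≤n a a′)) (m⊓n≤m a a′)
          (pred-< a′<b′ (m≤n⊔m b b′)) (<-≤-trans a<b (m≤m⊔n b b′)) (≤-suc-pred a′<b′ a≤b′)
        lo≡ : τ a ⊓ τ a′ ≡ τ (a ⊓ a′)
        lo≡ = sym (τ-⊓ safe⊔ (m⊓n≤m a a′) (m⊓n≤n a a′) (<-≤-trans a<b (m≤m⊔n b b′)) (<-≤-trans a′<b′ (m≤n⊔m b b′)))
        hi≡ : τʳ b ⊔ τʳ b′ ≡ τʳ (b ⊔ b′)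
        hi≡ = sym (τʳ-⊔ safe⊔ (≤-<-trans (m⊓n≤m a a′) a<b) (≤-<-trans (m⊓n≤n a a′) a′<b′) (m≤m⊔n b b′) (m≤n⊔m b b′))
        mem≡ : removeAt (removeAt (map moveCell mem) (k ⊔ l)) (k ⊓ l) ++ (fuse x y , τ a ⊓ τ a′ , τʳ b ⊔ τʳ b′) ∷ []
             ≡ map moveCell (rest ++ (fuse x y , a ⊓ a′ , b ⊔ b′) ∷ [])
        mem≡ = trans (cong₂ _++_
                       (trans (cong (λ m → removeAt m (k ⊓ l)) (removeAt-map moveCell mem (k ⊔ l)))
                              (removeAt-map moveCell (removeAt mem (k ⊔ l)) (k ⊓ l)))
                       (cong₂ (λ u v → (fuse x y , u , v) ∷ []) lo≡ hi≡))
                     (sym (map-++ moveCell rest _))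
        ks≡ : map τ ks ++ guide (P * M) (map τ K ++ map τ ks) (τ a ⊓ τ a′) (τʳ b ⊔ τʳ b′)
            ≡ map τ (ks ++ guide (P * M) (K ++ ks) (a ⊓ a′) (b ⊔ b′))
        ks≡ = begin
          map τ ks ++ guide (P * M) (map τ K ++ map τ ks) (τ a ⊓ τ a′) (τʳ b ⊔ τʳ b′)
            ≡⟨ cong₂ (λ u v → map τ ks ++ guide (P * M) (map τ K ++ map τ ks) u v) lo≡ hi≡ ⟩
          map τ ks ++ guide (P * M) (map τ K ++ map τ ks) (τ (a ⊓ a′)) (τʳ (b ⊔ b′))
            ≡⟨ cong (λ u → map τ ks ++ guide (P * M) u (τ (a ⊓ a′)) (τʳ (b ⊔ b′))) (map-++ τ K ks) ⟨
          map τ ks ++ guide (P * M) (map τ (K ++ ks)) (τ (a ⊓ a′)) (τʳ (b ⊔ b′))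
            ≡⟨ cong (map τ ks ++_) (guide-τ safe⊔ (interior T)) ⟩
          map τ ks ++ map τ (guide (P * M) (K ++ ks) (a ⊓ a′) (b ⊔ b′))
            ≡⟨ map-++ τ ks _ ⟨
          map τ (ks ++ guide (P * M) (K ++ ks) (a ⊓ a′) (b ⊔ b′)) ∎
          where open ≡-Reasoning

    moveRun : ∀ {r K p e f} → Star (LStep π r K p) e f → Tame K e →
      Star (LStep π′ r (map τ K) p) (moveLocal e) (moveLocal f) × Tame K f
    moveRun ε        T = ε , T
    moveRun (x ◅ xs) T with moveLStep x T
    ... | x′ , T′ with moveRun xs T′
    ...   | xs′ , T″ = x′ ◅ xs′ , T″

    record TameState (S : State) : Set where
      field
        interior  : All Interior (proj₁ S)
        proper    : ∀ p → AllIv _<_ (memory S p)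
        uncrossed : ∀ {z} → Guarded z → ∀ p → AllIv (Uncrossed z) (memory S p)

    sent-move : ∀ {r K p} e q → All Interior (K ++ proj₂ e) →
      sent π′ r (map τ K) p (moveLocal e) q ≡ map moveCell (sent π r K p e q)
    sent-move {r} {K} {p} e q ints = begin
      mapMaybe f′ (Strategy.comm s (view π′ r (map τ K) p (moveLocal e)))
                                               ≡⟨ cong (mapMaybe f′ ∘ Strategy.comm s) (view-move {r} {K} {p} e ints) ⟩
      mapMaybe f′ orders                         ≡⟨ mapMaybe-cong f′≡ orders ⟩
      mapMaybe (Maybe.map moveCell ∘ f) orders   ≡⟨ map-mapMaybe moveCell f orders ⟨
      map moveCell (mapMaybe f orders)           ∎
      where
      open ≡-Reasoning
      orders = Strategy.comm s (view π r K p e)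
      f f′ : ℕ × Fin P → Maybe (Cell P M)
      f  d = if does (proj₂ d Fin.≟ q) then nth (proj₁ e) (proj₁ d) else nothing
      f′ d = if does (proj₂ d Fin.≟ q) then nth (map moveCell (proj₁ e)) (proj₁ d) else nothing
      f′≡ : ∀ d → f′ d ≡ Maybe.map moveCell (f d)
      f′≡ d with does (proj₂ d Fin.≟ q)
      ... | true  = nth-map moveCell (proj₁ e) (proj₁ d)
      ... | false = refl

    -- Without contacts at guarded points, being uncrossed at the beginning strengthens to being
    -- unfusable. That lasts through the round and gives uncrossed memories for the next one.
    moveRound : ∀ {r S S′} → Round π r S S′ → TameState S → (∀ {z} → Guarded z → (z , z) ∉ contacts S) →
      Round π′ r (moveState S) (moveState S′) × TameState S′
    moveRound {r} {S} {S′} R T nc = record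
        { end      = moveLocal ∘ end
        ; runs     = λ p → subst (λ m → Star (LStep π′ r (map τ K₀) p) (m , []) (moveLocal (end p)))
                             (sym (memory-move S p)) (proj₁ (moved p))
        ; finished = λ p → trans (cong (Strategy.local s) (view-move (end p) (Tame.interior (tame p)))) (finished p)
        ; memBd    = λ q → subst (λ m → length m ≤ M) (sym (memory-move S′ q))
                             (subst (_≤ M) (sym (length-map moveCell (memory S′ q))) (memBd q))
        ; result   = trans (cong moveState result) (cong₂ _,_ K≡ mems≡) }
      , record
        { interior  = subst (All Interior) (sym (cong proj₁ result))
                        (All.++⁺ (interior T) (concatMap-All _ (allFin P) λ p → All.++⁻ʳ K₀ (Tame.interior (tame p))))
        ; proper    = Round-All {Φ = _<_} R (λ p → Tame.proper (tame p))
        ; uncrossed = λ {z} g → Round-All {Φ = Uncrossed z} R (λ p → unfusable⇒uncrossed {z} (Tame.unfusable (tame p) g)) }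
      where
      open Round R
      open TameState
      K₀ = proj₁ S
      moved : ∀ p → Star (LStep π′ r (map τ K₀) p) (moveLocal (memory S p , [])) (moveLocal (end p)) × Tame K₀ (end p)
      moved p = moveRun (runs p) record
        { interior  = subst (All Interior) (sym (++-identityʳ K₀)) (interior T)
        ; proper    = proper T p
        ; unfusable = λ {z} g → noContact⇒unfusable {S} {p} {z} (nc g) (uncrossed T g p) }
      tame : ∀ p → Tame K₀ (end p)
      tame p = proj₂ (moved p)
      K≡ : map τ (K₀ ++ concatMap (proj₂ ∘ end) (allFin P)) ≡ map τ K₀ ++ concatMap (map τ ∘ proj₂ ∘ end) (allFin P)
      K≡ = trans (map-++ τ K₀ _) (cong (map τ K₀ ++_) (map-concatMap τ (proj₂ ∘ end) (allFin P)))
      mems≡ : Vec.map (map moveCell) (tabulate (λ q → concatMap (λ p → sent π r K₀ p (end p) q) (allFin P)))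
            ≡ tabulate (λ q → concatMap (λ p → sent π′ r (map τ K₀) p (moveLocal (end p)) q) (allFin P))
      mems≡ = trans (sym (tabulate-∘ (map moveCell) _)) (tabulate-cong λ q →
        trans (map-concatMap moveCell (λ p → sent π r K₀ p (end p) q) (allFin P))
              (concatMap-cong (λ p → sym (sent-move (end p) q (Tame.interior (tame p)))) (allFin P)))

    revealSeq-move : ∀ {ks} cs → All Interior ks → All (λ x → Safe (lo P M x) (hi P M x)) cs →
      revealSeq P M π′ s (map τ ks) (map moveCell cs) ≡ map τ (revealSeq P M π s ks cs)
      × All Interior (revealSeq P M π s ks cs)
    revealSeq-move []       ints []       = refl , ints
    revealSeq-move {ks} ((x , a , b) ∷ cs) ints (sf ∷ sfs)
      with revealSeq-move cs (All.++⁺ ints (guide-interior ks sf)) sfs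
    ... | eq , ints′ = trans (cong (λ l → revealSeq P M π′ s l (map moveCell cs))
                         (trans (cong (map τ ks ++_) (guide-τ sf ints)) (sym (map-++ τ ks _)))) eq
                     , ints′

    safe-unit : ∀ a → Safe a (suc a)
    safe-unit a = safe (n<1+n a) (λ {_} {z} _ _ → uncrossed-unit {π} z a)

    initMem-move : ∀ p → initMem P M π′ s p ≡ map moveCell (initMem P M π s p)
    initMem-move p = trans (map-cong (λ m → cong (λ x → leaf p m , x , suc x) (toℕ-τFin (Inverse.to π (p , m)))) (allFin M))
                           (map-∘ (allFin M))

    move-initial : moveState (initial π) ≡ initial π′ × TameState (initial π)
    move-initial = cong₂ _,_ (trans (sym (proj₁ revealed)) (cong (revealSeq P M π′ s [])
                       (trans (map-concatMap moveCell (initMem P M π s) (allFin P))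
                              (concatMap-cong (λ p → sym (initMem-move p)) (allFin P)))))
                     (trans (sym (tabulate-∘ (map moveCell) _)) (tabulate-cong (λ p → sym (initMem-move p))))
                 , record
                     { interior  = proj₂ revealed
                     ; proper    = memory-initial {π} {_<_} n<1+n
                     ; uncrossed = λ {z} _ → memory-initial {π} {Uncrossed z} (uncrossed-unit {π} z) }
      where
      revealed = revealSeq-move (concatMap (initMem P M π s) (allFin P)) []
                   (concatMap-All _ (allFin P) (initMem-All {π} {Safe} safe-unit))

    -- Contacts at guarded points are excluded in the earlier states only. The latest state may have
    -- them; there the exchange is meant to remove a bad point.
    moveHistory : ∀ {S Ss} → History π (S ∷ Ss) →
      All (λ S′ → ∀ {z} → Guarded z → (z , z) ∉ contacts S′) Ss →
      History π′ (map moveState (S ∷ Ss)) × TameState S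
    moveHistory start [] = subst (λ S → History π′ (S ∷ [])) (sym (proj₁ move-initial)) start , proj₂ move-initial
    moveHistory (round {S} {Ss = Ss} H R) (nc ∷ ncs) with moveHistory H ncs
    ... | H′ , T with moveRound R T nc
    ...   | R′ , T′ = round H′ (subst (λ r → Round π′ r _ _) (sym (length-map moveState Ss)) R′) , T′

-- Bad points and their removal

unique-⊆⇒length≤ : ∀ {A : Set} {xs ys : List A} → Unique xs → (∀ {x} → x ∈ xs → x ∈ ys) → length xs ≤ length ys
unique-⊆⇒length≤ {xs = []} [] sub = z≤n
unique-⊆⇒length≤ {xs = x ∷ xs} {ys} (x∉xs ∷ uxs) sub with ∈-∃++ (sub (here refl))
... | as , bs , refl = begin
  suc (length xs)                ≤⟨ s≤s (unique-⊆⇒length≤ uxs sub′) ⟩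
  suc (length (as ++ bs))        ≡⟨ cong suc (length-++ as) ⟩
  suc (length as + length bs)    ≡⟨ +-suc (length as) (length bs) ⟨
  length as + suc (length bs)    ≡⟨ length-++ as ⟨
  length (as ++ x ∷ bs)          ∎
  where
  open ≤-Reasoning
  sub′ : ∀ {y} → y ∈ xs → y ∈ as ++ bs
  sub′ {y} y∈xs with ∈-++⁻ as (sub (there y∈xs))
  ... | inj₁ y∈as         = ∈-++⁺ˡ y∈as
  ... | inj₂ (here refl)  = contradiction refl (All.lookup x∉xs y∈xs)
  ... | inj₂ (there y∈bs) = ∈-++⁺ʳ as y∈bs

module _ {A : Set} (_≟A_ : DecidableEquality A) where

  open DecMembership _≟A_ using (_∈?_)

  ∃-outside : ∀ {xs ys : List A} → Unique xs → length ys < length xs → ∃ λ x → x ∈ xs × x ∉ ys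
  ∃-outside {xs} {ys} uxs lt with any? (λ x → ¬? (x ∈? ys)) xs
  ... | yes some = find some
  ... | no none  = contradiction (unique-⊆⇒length≤ uxs sub) (<⇒≱ lt)
    where
    sub : ∀ {x} → x ∈ xs → x ∈ ys
    sub {x} x∈ = decidable-stable (x ∈? ys) (λ x∉ → none (lose x∈ x∉))

length-concatMap≤ : ∀ {A B : Set} (f : A → List B) {k} xs → All (λ x → length (f x) ≤ k) xs →
  length (concatMap f xs) ≤ length xs * k
length-concatMap≤ f []       []       = z≤n
length-concatMap≤ f {k} (x ∷ xs) (q ∷ qs) = subst (_≤ k + length xs * k) (sym (length-++ (f x))) (+-mono-≤ q (length-concatMap≤ f xs qs))

length-cartesianProductWith : ∀ {A B C : Set} (f : A → B → C) xs ys →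
  length (cartesianProductWith f xs ys) ≡ length xs * length ys
length-cartesianProductWith f []       ys = refl
length-cartesianProductWith f (x ∷ xs) ys = trans (length-++ (map (f x) ys))
  (cong₂ _+_ (length-map (f x) ys) (length-cartesianProductWith f xs ys))

_≟²_ : DecidableEquality (ℕ × ℕ)
_≟²_ = ≡-dec _≟_ _≟_

open DecMembership _≟²_ using () renaming (_∈?_ to _∈²?_)
open DecMembership _≟_ using () renaming (_∈?_ to _∈ℕ?_; _∉?_ to _∉ℕ?_)

module Premature (P M : ℕ) (s : Strategy P M) where

  open Invariants P M s

  Bad : ℕ → State → ℕ → Set
  Bad r S c = 0 < c × 2 ^ suc r ∣ c × (c , c) ∈ contacts S

  bad? : ∀ r S c → Dec (Bad r S c)
  bad? r S c = 0 <? c ×-dec (2 ^ suc r ∣? c) ×-dec ((c , c) ∈²? contacts S)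

  badsOf : ℕ → State → List ℕ
  badsOf r S = filter (bad? r S) (upTo (P * M))

  -- With the latest state first, `S` is the state at the beginning of round `length Ss`.
  bads : List State → List ℕ
  bads []       = []
  bads (S ∷ Ss) = badsOf (length Ss) S ++ bads Ss

  ∈-badsOf⁺ : ∀ r S {c} → c < P * M → Bad r S c → c ∈ badsOf r S
  ∈-badsOf⁺ r S c<N b = ∈-filter⁺ (bad? r S) (∈-upTo⁺ c<N) b

  ∈-badsOf⁻ : ∀ r S {c} → c ∈ badsOf r S → c < P * M × Bad r S c
  ∈-badsOf⁻ r S c∈ with ∈-filter⁻ (bad? r S) {xs = upTo (P * M)} c∈
  ... | c∈upTo , b = ∈-upTo⁻ c∈upTo , b

  badsOf-unique : ∀ r S → Unique (badsOf r S)
  badsOf-unique r S = Unique.filter⁺ (bad? r S) (Unique.upTo⁺ (P * M))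

  -- Every round `r` in the list has `suc r ≤ k`, so a contact at a multiple of `2 ^ k` would be bad
  -- in it.
  ∉bads⇒noContact : ∀ {z Ss k} → 0 < z → z < P * M → 2 ^ k ∣ z → length Ss ≤ k → z ∉ bads Ss →
    All (λ S → (z , z) ∉ contacts S) Ss
  ∉bads⇒noContact {Ss = []}     _   _   _   _  _  = []
  ∉bads⇒noContact {z} {S ∷ Ss} {k} 0<z z<N 2^∣z le z∉ =
    (λ c∈ → z∉ (∈-++⁺ˡ (∈-badsOf⁺ (length Ss) S z<N (0<z , ∣-trans (2^-mono-∣ le) 2^∣z , c∈))))
    ∷ ∉bads⇒noContact {k = k} 0<z z<N 2^∣z (≤-trans (n≤1+n _) le) (z∉ ∘ ∈-++⁺ʳ (badsOf (length Ss) S))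

  history-proper : ∀ {π Ss} → History π Ss → All (λ S → ∀ p → AllIv _<_ (memory S p)) Ss
  history-proper {π} start = memory-initial {π} {_<_} n<1+n ∷ []
  history-proper (round H R) with history-proper H
  ... | proper ∷ rest = Round-All {Φ = _<_} R (λ p → run-All {Φ = _<_} <-closed (Round.runs R p) (proper p)) ∷ proper ∷ rest

  length-contacts : ∀ S → (∀ p → length (memory S p) ≤ M) → length (contacts S) ≤ P * (M * M)
  length-contacts S bd = subst (λ n → length (contacts S) ≤ n * (M * M)) (length-tabulate {n = P} (λ p → p))
    (length-concatMap≤ (endpoints ∘ memory S) (allFin P) (All.universal
      (λ p → subst (_≤ M * M) (sym (length-cartesianProductWith _ (memory S p) (memory S p))) (*-mono-≤ (bd p) (bd p))) (allFin P)))

  length-allContacts : ∀ {π Ss} → History π Ss → length (concatMap contacts Ss) ≤ length Ss * (P * (M * M))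
  length-allContacts {Ss = Ss} H = length-concatMap≤ contacts Ss (All.map (λ {S} → length-contacts S) (history-memory-bound H))

-- The two blocks are distinct and not adjacent, so the neighbours of each stay in place.
module SwapEffect (P M : ℕ) (s : Strategy P M)
  (t w : ℕ) (w≡ : w ≡ 2 ^ suc t) .{{_ : NonZero w}} (nw i j : ℕ) (PM≡ : P * M ≡ nw * w)
  (0<i : 0 < i) (0<j : 0 < j) (i<nw : suc i < nw) (j<nw : suc j < nw)
  (i≢j : i ≢ j) (si≢j : suc i ≢ j) (i≢sj : i ≢ suc j) where

  open Simulation P M s t w w≡ nw i j PM≡ 0<i 0<j i<nw j<nw public
  open Premature P M s public

  -- After the exchange, whatever ended at `i * w` meets at that point whatever started at `j * w`;
  -- the other three breaks are similar. The fields exclude the four pairs that would thus become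
  -- contacts at breaks.
  record Compatible (S : State) : Set where
    field
      i∣j   : (i * w , j * w) ∉ contacts S
      j∣i   : (j * w , i * w) ∉ contacts S
      i′∣j′ : (suc i * w , suc j * w) ∉ contacts S
      j′∣i′ : (suc j * w , suc i * w) ∉ contacts S

  sw-suc : ∀ {k} → k ≢ i → k ≢ j → sw k ≡ k
  sw-suc {k} = transpose-other {i} {j} {k}

  τʳ-*-fixed : ∀ {k} → 0 < k → pred k ≢ i → pred k ≢ j → τʳ (k * w) ≡ k * w
  τʳ-*-fixed {suc k} _ ≢i ≢j = trans (τʳ-* k) (cong (λ l → suc l * w) (sw-suc ≢i ≢j))

  τ-*-fixed : ∀ {k} → k ≢ i → k ≢ j → τ (k * w) ≡ k * w
  τ-*-fixed {k} ≢i ≢j = trans (τ-* k) (cong (_* w) (sw-suc ≢i ≢j))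

  pred≢ : ∀ {k l} → 0 < k → k ≢ suc l → pred k ≢ l
  pred≢ {suc k} _ k≢sl refl = k≢sl refl

  pred≢self : ∀ {k} → 0 < k → pred k ≢ k
  pred≢self {suc k} _ eq = <-irrefl eq (n<1+n k)

  -- A contact at `c` after the exchange comes from the pair `(τʳ c , τ c)`, which at a break is one
  -- of the four excluded by `Compatible`.
  break∉contacts : ∀ {S c} → Compatible S → Break c → (τʳ c , τ c) ∉ contacts S
  break∉contacts {S} cp break-i = Compatible.i∣j cp ∘ subst₂ (λ u v → (u , v) ∈ contacts S)
    (τʳ-*-fixed 0<i (pred≢self 0<i) (pred≢ 0<i i≢sj)) (trans (τ-* i) (cong (_* w) (transpose-fst i j)))
  break∉contacts {S} cp break-j = Compatible.j∣i cp ∘ subst₂ (λ u v → (u , v) ∈ contacts S)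
    (τʳ-*-fixed 0<j (pred≢ 0<j (si≢j ∘ sym)) (pred≢self 0<j)) (trans (τ-* j) (cong (_* w) (transpose-snd i j)))
  break∉contacts {S} cp break-i′ = Compatible.j′∣i′ cp ∘ subst₂ (λ u v → (u , v) ∈ contacts S)
    (trans (τʳ-* i) (cong (λ k → suc k * w) (transpose-fst i j))) (τ-*-fixed (λ eq → <-irrefl (sym eq) (n<1+n i)) si≢j)
  break∉contacts {S} cp break-j′ = Compatible.i′∣j′ cp ∘ subst₂ (λ u v → (u , v) ∈ contacts S)
    (trans (τʳ-* j) (cong (λ k → suc k * w) (transpose-snd i j))) (τ-*-fixed (i≢sj ∘ sym) (λ eq → <-irrefl (sym eq) (n<1+n j)))

  contacts-move⁻ : ∀ {S h l} → (∀ p → AllIv _<_ (memory S p)) → (h , l) ∈ contacts (moveState S) → (τʳ h , τ l) ∈ contacts S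
  contacts-move⁻ {S} proper hl∈ with contacts⁻ (moveState S) hl∈
  ... | p , x′ , y′ , x′∈ , y′∈ , refl with ∈-map⁻ moveCell (subst (x′ ∈_) (memory-move S p) x′∈)
                                           | ∈-map⁻ moveCell (subst (y′ ∈_) (memory-move S p) y′∈)
  ... | x , x∈ , refl | y , y∈ , refl = subst₂ (λ u v → (u , v) ∈ contacts S)
    (sym (τʳ-involutive (≤-<-trans z≤n (All.lookup (proper p) x∈)))) (sym (τ-involutive (lo P M y))) (contacts⁺ S p x∈ y∈)

  -- A point bad after the exchange is no break, so both of its endpoints come from the single point
  -- `τ c`. Since `2 ^ suc r` divides `w`, residues modulo `w` preserve the divisibility.
  Bad-move⁻ : ∀ {r S c} → r ≤ t → (∀ p → AllIv _<_ (memory S p)) → Compatible S →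
    Bad r (moveState S) c → Bad r S (τ c) × ¬ Break c
  Bad-move⁻ {r} {S} {c} r≤t proper cp (0<c , 2^∣c , c∈) =
    (τ-0< 0<c , %≡⇒∣ (subst (2 ^ suc r ∣_) (sym w≡) (2^-mono-∣ (s≤s r≤t))) (sym (τ-% c)) 2^∣c , c∈′) , ¬brk
    where
    τc∈ : (τʳ c , τ c) ∈ contacts S
    τc∈ = contacts-move⁻ {S} proper c∈
    ¬brk : ¬ Break c
    ¬brk brk = break∉contacts {S} cp brk τc∈
    c∈′ : (τ c , τ c) ∈ contacts S
    c∈′ = subst (λ u → (u , τ c) ∈ contacts S) (sym (¬Break⇒τ≡τʳ 0<c ¬brk)) τc∈

  map-τ-unique : ∀ {xs} → Unique xs → Unique (map τ xs)
  map-τ-unique = Unique.map⁺ τ-injective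

  badsOf-move⊆ : ∀ {r S} → r ≤ t → (∀ p → AllIv _<_ (memory S p)) → Compatible S →
    ∀ {c} → c ∈ map τ (badsOf r (moveState S)) → c ∈ badsOf r S × (∀ {b} → Break b → c ≢ τ b)
  badsOf-move⊆ {r} {S} r≤t proper cp c∈ with ∈-map⁻ τ c∈
  ... | x , x∈ , refl with ∈-badsOf⁻ r (moveState S) x∈
  ... | x<N , b with Bad-move⁻ {r} {S} r≤t proper cp b
  ... | b′ , ¬brk = ∈-badsOf⁺ r S (τ-<N x<N) b′ , λ brk eq → ¬brk (subst Break (sym (τ-injective eq)) brk)

  badsOf-move≤ : ∀ {r S} → r ≤ t → (∀ p → AllIv _<_ (memory S p)) → Compatible S →
    length (badsOf r (moveState S)) ≤ length (badsOf r S)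
  badsOf-move≤ {r} {S} r≤t proper cp = subst (_≤ length (badsOf r S)) (length-map τ (badsOf r (moveState S)))
    (unique-⊆⇒length≤ (map-τ-unique (badsOf-unique r (moveState S))) (proj₁ ∘ badsOf-move⊆ {r} {S} r≤t proper cp))

  -- `τ` injects the new bad points into the old ones and misses `i * w`: that is the image of the
  -- break `j * w`, which is not bad after the exchange.
  badsOf-move< : ∀ {r S} → r ≤ t → (∀ p → AllIv _<_ (memory S p)) → Compatible S → i * w ∈ badsOf r S →
    length (badsOf r (moveState S)) < length (badsOf r S)
  badsOf-move< {r} {S} r≤t proper cp i∈ = subst (λ n → suc n ≤ length (badsOf r S)) (length-map τ (badsOf r (moveState S)))
    (unique-⊆⇒length≤ (All.tabulate fresh ∷ map-τ-unique (badsOf-unique r (moveState S)))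
      (λ { (here refl) → i∈ ; (there c∈) → proj₁ (badsOf-move⊆ {r} {S} r≤t proper cp c∈) }))
    where
    fresh : ∀ {c} → c ∈ map τ (badsOf r (moveState S)) → i * w ≢ c
    fresh c∈ refl = proj₂ (badsOf-move⊆ {r} {S} r≤t proper cp c∈) break-j
      (sym (trans (τ-* j) (cong (_* w) (transpose-snd i j))))

  bads-move≤ : ∀ {Ss} → length Ss ≤ suc t → All (λ S → ∀ p → AllIv _<_ (memory S p)) Ss → All Compatible Ss →
    length (bads (map moveState Ss)) ≤ length (bads Ss)
  bads-move≤ {[]}     _  _ _ = z≤n
  bads-move≤ {S ∷ Ss} (s≤s le) (pr ∷ prs) (cp ∷ cps) = subst₂ _≤_
    (sym (trans (cong (λ r → length (badsOf r (moveState S) ++ bads (map moveState Ss))) (length-map moveState Ss)) (length-++ (badsOf (length Ss) (moveState S)))))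
    (sym (length-++ (badsOf (length Ss) S)))
    (+-mono-≤ (badsOf-move≤ {length Ss} {S} le pr cp) (bads-move≤ (≤-trans le (n≤1+n t)) prs cps))


-- Existence of a harmless exchange

module Improve (P M : ℕ) (s : Strategy P M)
  (t w : ℕ) (w≡ : w ≡ 2 ^ suc t) .{{_ : NonZero w}} (nw : ℕ) (PM≡ : P * M ≡ nw * w) where

  open Invariants P M s
  open Premature P M s

  h = 2 ^ t

  w≡h+h : w ≡ h + h
  w≡h+h = trans w≡ (cong (h +_) (+-identityʳ h))

  h<w : h < w
  h<w = subst (h <_) (sym w≡) (^-monoʳ-< 2 (s≤s (s≤s z≤n)) (n<1+n t))

  h∣w : h ∣ w
  h∣w = subst (h ∣_) (sym w≡) (n∣m*n 2)

  -- If `z` lies in block `k` widened by `h` on both sides, the quotient `q` is between `k` and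
  -- `k + 2`; this leaves three candidates for `k`.
  blocksNear : ℕ → List ℕ
  blocksNear z = let q = (z + h) / w in q ∷ pred q ∷ pred (pred q) ∷ []

  ∈-blocksNear : ∀ {k z} → k * w ≤ z + h → z ≤ suc k * w + h → k ∈ blocksNear z
  ∈-blocksNear {k} {z} kw≤ z≤ = go ((z + h) / w) k≤q q≤
    where
    k≤q : k ≤ (z + h) / w
    k≤q = subst (_≤ (z + h) / w) (m*n/n≡m k w) (/-monoˡ-≤ w kw≤)
    q≤ : (z + h) / w ≤ suc (suc k)
    q≤ = subst ((z + h) / w ≤_) (m*n/n≡m (suc (suc k)) w) (/-monoˡ-≤ w (begin
      z + h                   ≤⟨ +-monoˡ-≤ h z≤ ⟩
      suc k * w + h + h       ≡⟨ +-assoc (suc k * w) h h ⟩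
      suc k * w + (h + h)     ≡⟨ cong (suc k * w +_) w≡h+h ⟨
      suc k * w + w           ≡⟨ +-comm (suc k * w) w ⟩
      suc (suc k) * w         ∎))
      where open ≤-Reasoning
    go : ∀ q → k ≤ q → q ≤ suc (suc k) → k ∈ q ∷ pred q ∷ pred (pred q) ∷ []
    go q k≤q q≤ with m≤n⇒m<n∨m≡n q≤
    ... | inj₂ refl = there (there (here refl))
    ... | inj₁ (s≤s q≤sk) with m≤n⇒m<n∨m≡n q≤sk
    ...   | inj₂ refl = there (here refl)
    ...   | inj₁ (s≤s q≤k) = here (≤-antisym k≤q q≤k)

  module _ (past : List State) where

    Good : ℕ → Set
    Good k = 0 < k × suc k < nw × k ∉ concatMap blocksNear (bads past)

    good? : ∀ k → Dec (Good k)
    good? k = 0 <? k ×-dec suc k <? nw ×-dec k ∉ℕ? concatMap blocksNear (bads past)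

    goodBlocks : List ℕ
    goodBlocks = filter good? (upTo nw)

    exceptions : List ℕ
    exceptions = 0 ∷ pred nw ∷ concatMap blocksNear (bads past)

    length-exceptions : length exceptions ≤ 2 + length (bads past) * 3
    length-exceptions = +-monoʳ-≤ 2 (length-concatMap≤ blocksNear (bads past) (All.universal (λ _ → ≤-refl) (bads past)))

    good-or-exception : ∀ {k} → k < nw → k ∈ goodBlocks ⊎ k ∈ exceptions
    good-or-exception {zero}  _ = inj₂ (here refl)
    good-or-exception {suc k} k<nw with suc (suc k) <? nw | suc k ∈ℕ? concatMap blocksNear (bads past)
    ... | no k≮  | _       = inj₂ (there (here (cong pred (≤-antisym k<nw (≮⇒≥ k≮)))))
    ... | yes _  | yes k∈  = inj₂ (there (there k∈))
    ... | yes k< | no k∉   = inj₁ (∈-filter⁺ good? (∈-upTo⁺ k<nw) (s≤s z≤n , k< , k∉))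

    -- The 2 stands for the first and the last block, the 3 for the blocks near an older bad point.
    nw≤ : nw ≤ length goodBlocks + (2 + length (bads past) * 3)
    nw≤ = begin
      nw                                      ≡⟨ length-upTo nw ⟨
      length (upTo nw)                        ≤⟨ unique-⊆⇒length≤ (Unique.upTo⁺ nw) sub ⟩
      length (goodBlocks ++ exceptions)       ≡⟨ length-++ goodBlocks ⟩
      length goodBlocks + length exceptions   ≤⟨ +-monoʳ-≤ (length goodBlocks) length-exceptions ⟩
      length goodBlocks + (2 + length (bads past) * 3) ∎
      where
      open ≤-Reasoning
      sub : ∀ {k} → k ∈ upTo nw → k ∈ goodBlocks ++ exceptions
      sub k∈ with good-or-exception (∈-upTo⁻ k∈)
      ... | inj₁ g = ∈-++⁺ˡ g
      ... | inj₂ e = ∈-++⁺ʳ goodBlocks e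

    goodBlocks⇒good : ∀ {k} → k ∈ goodBlocks → Good k
    goodBlocks⇒good k∈ = proj₂ (∈-filter⁻ good? {xs = upTo nw} k∈)

    -- As a multiple of `h`, which is `2 ^ t`, the point `z` would be bad in any earlier round that
    -- has a contact there, and then the block near it would not be good.
    good⇒noContact : ∀ {k z} → length past ≤ t → Good k → k * w ≤ z + h → z ≤ suc k * w + h → h ∣ z →
      All (λ S → (z , z) ∉ contacts S) past
    good⇒noContact {k} {z} le (0<k , sk<nw , k∉) kw≤ z≤ h∣z =
      ∉bads⇒noContact {k = t} (0<z z kw≤) z<N h∣z le
        (λ z∈ → k∉ (∈-concatMap⁺ blocksNear (lose z∈ (∈-blocksNear kw≤ z≤))))
      where
      0<z : ∀ z → k * w ≤ z + h → 0 < z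
      0<z zero    kw≤h = contradiction (≤-trans (m≤n*m w k {{>-nonZero 0<k}}) kw≤h) (<⇒≱ h<w)
      0<z (suc _) _    = s≤s z≤n
      z<N : z < P * M
      z<N = begin-strict
        z                  ≤⟨ z≤ ⟩
        suc k * w + h      <⟨ +-monoʳ-< (suc k * w) h<w ⟩
        suc k * w + w      ≡⟨ +-comm (suc k * w) w ⟩
        suc (suc k) * w    ≤⟨ *-monoˡ-≤ w sk<nw ⟩
        nw * w             ≡⟨ PM≡ ⟨
        P * M              ∎
        where open ≤-Reasoning

    module _ (now : State) where

      targets : List ℕ
      targets = filter (λ k → (k * w) ∈ℕ? badsOf t now) goodBlocks

      targets⇒ : ∀ {k} → k ∈ targets → Good k × k * w ∈ badsOf t now
      targets⇒ k∈ with ∈-filter⁻ (λ k → (k * w) ∈ℕ? badsOf t now) {xs = goodBlocks} k∈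
      ... | k∈good , kw∈ = goodBlocks⇒good k∈good , kw∈

      -- A bad point of round `t` is a multiple of `w`, hence the left end of a block; if that block
      -- is good, it is a target.
      badsOf≤ : length (badsOf t now) ≤ length targets + (2 + length (bads past) * 3)
      badsOf≤ = begin
        length (badsOf t now)                            ≤⟨ unique-⊆⇒length≤ (badsOf-unique t now) sub ⟩
        length (map (_* w) (targets ++ exceptions))      ≡⟨ length-map (_* w) (targets ++ exceptions) ⟩
        length (targets ++ exceptions)                   ≡⟨ length-++ targets ⟩
        length targets + length exceptions               ≤⟨ +-monoʳ-≤ (length targets) length-exceptions ⟩
        length targets + (2 + length (bads past) * 3)    ∎
        where
        open ≤-Reasoning
        sub : ∀ {c} → c ∈ badsOf t now → c ∈ map (_* w) (targets ++ exceptions)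
        sub {c} c∈ with ∈-badsOf⁻ t now c∈
        ... | c<N , _ , 2^∣c , _ with subst (_∣ c) (sym w≡) 2^∣c
        ... | divides-refl k with good-or-exception (*-cancelʳ-< w k nw (subst (k * w <_) PM≡ c<N))
        ... | inj₁ g = ∈-map⁺ (_* w) (∈-++⁺ˡ (∈-filter⁺ (λ k → (k * w) ∈ℕ? badsOf t now) g c∈))
        ... | inj₂ e = ∈-map⁺ (_* w) (∈-++⁺ʳ targets e)

      allContacts : List (ℕ × ℕ)
      allContacts = concatMap contacts (now ∷ past)

      -- The exchanges (k , l) that would move the endpoints b and a onto one point.
      spoiled : ℕ × ℕ → List (ℕ × ℕ)
      spoiled (b , a) = (b / w , a / w) ∷ (a / w , b / w) ∷ (pred (b / w) , pred (a / w)) ∷ (pred (a / w) , pred (b / w)) ∷ []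

      tooClose : ℕ → List (ℕ × ℕ)
      tooClose k = (k , k) ∷ (k , suc k) ∷ (k , pred k) ∷ []

      forbidden : List (ℕ × ℕ)
      forbidden = concatMap spoiled allContacts ++ concatMap tooClose targets

      length-forbidden : length forbidden ≤ length allContacts * 4 + length targets * 3
      length-forbidden = subst (_≤ length allContacts * 4 + length targets * 3) (sym (length-++ (concatMap spoiled allContacts)))
        (+-mono-≤ (length-concatMap≤ spoiled allContacts (All.universal (λ _ → ≤-refl) allContacts))
                  (length-concatMap≤ tooClose targets (All.universal (λ _ → ≤-refl) targets)))

  record Improved (past : List State) (now : State) : Set where
    field
      {perm}   : Perm P M
      {past′}  : List State
      {now′}   : State
      history  : History perm (now′ ∷ past′)
      length≡  : length past′ ≡ length past
      past≤    : length (bads past′) ≤ length (bads past)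
      now<     : length (badsOf t now′) < length (badsOf t now)

  -- Counting gives a target `i` and a good block `j` whose pair is not forbidden. Goodness clears
  -- the guarded points of earlier contacts, so the history can be transported; that the pair is not
  -- spoiled makes all states compatible.
  improve : ∀ {π past now} → History π (now ∷ past) → length past ≡ t →
    length (forbidden past now) < length (targets past now) * length (goodBlocks past) → Improved past now
  improve {π} {past} {now} H len lt
    with ∃-outside _≟²_ {cartesianProduct (targets past now) (goodBlocks past)} {forbidden past now}
           (Unique.cartesianProduct⁺ (Unique.filter⁺ _ (Unique.filter⁺ _ (Unique.upTo⁺ nw))) (Unique.filter⁺ _ (Unique.upTo⁺ nw)))
           (subst (length (forbidden past now) <_) (sym (length-cartesianProductWith _,_ (targets past now) (goodBlocks past))) lt)
  ... | (i , j) , ij∈ , ij∉ with ∈-cartesianProduct⁻ (targets past now) (goodBlocks past) ij∈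
  ... | i∈ , j∈ with targets⇒ past now i∈ | goodBlocks⇒good past j∈
  ... | gi@(0<i , i<nw , _) , iw∈ | gj@(0<j , j<nw , _) = record
    { history = proj₁ (moveHistory π H noContacts)
    ; length≡ = length-map moveState past
    ; past≤   = bads-move≤ (≤-trans (≤-reflexive len) (n≤1+n t)) (All.tail propers) (All.tail compatibles)
    ; now<    = badsOf-move< {t} {now} ≤-refl (All.head propers) (All.head compatibles) iw∈ }
    where
    close∉ : (i , j) ∉ tooClose past now i
    close∉ c∈ = ij∉ (∈-++⁺ʳ (concatMap (spoiled past now) (allContacts past now)) (∈-concatMap⁺ (tooClose past now) (lose i∈ c∈)))
    i≢j : i ≢ j
    i≢j refl = close∉ (here refl)
    si≢j : suc i ≢ j
    si≢j refl = close∉ (there (here refl))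
    i≢sj : i ≢ suc j
    i≢sj refl = close∉ (there (there (here refl)))
    open SwapEffect P M s t w w≡ nw i j PM≡ 0<i 0<j i<nw j<nw i≢j si≢j i≢sj
      using (moveHistory; moveState; bads-move≤; badsOf-move<; Compatible; Guarded; Break; Guard;
             break-i; break-i′; break-j; break-j′; at; after; before)
    propers = history-proper H
    spoiled∉ : ∀ {S c} → S ∈ now ∷ past → c ∈ contacts S → (i , j) ∉ spoiled past now c
    spoiled∉ S∈ c∈ ij = ij∉ (∈-++⁺ˡ (∈-concatMap⁺ (spoiled past now) (lose (∈-concatMap⁺ contacts (lose S∈ c∈)) ij)))
    /w : ∀ k → k * w / w ≡ k
    /w k = m*n/n≡m k w
    compatibles : All Compatible (now ∷ past)
    compatibles = All.tabulate λ S∈ → record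
      { i∣j   = λ c∈ → spoiled∉ S∈ c∈ (here (sym (cong₂ _,_ (/w i) (/w j))))
      ; j∣i   = λ c∈ → spoiled∉ S∈ c∈ (there (here (sym (cong₂ _,_ (/w i) (/w j)))))
      ; i′∣j′ = λ c∈ → spoiled∉ S∈ c∈ (there (there (here (sym (cong₂ _,_ (cong pred (/w (suc i))) (cong pred (/w (suc j))))))))
      ; j′∣i′ = λ c∈ → spoiled∉ S∈ c∈ (there (there (there (here (sym (cong₂ _,_ (cong pred (/w (suc i))) (cong pred (/w (suc j))))))))) }
    guard-near : ∀ {k c z} → c ≡ k * w ⊎ c ≡ suc k * w → Guard c z → k * w ≤ z + h × z ≤ suc k * w + h × h ∣ z
    guard-near {k} {c} {z} c≡ g = ≤-trans kw≤c (proj₁ (offset g)) , ≤-trans (proj₁ (proj₂ (offset g))) (+-monoˡ-≤ h c≤kw+w) , proj₂ (proj₂ (offset g))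
      where
      range : c ≡ k * w ⊎ c ≡ suc k * w → k * w ≤ c × c ≤ suc k * w × h ∣ c
      range (inj₁ refl) = ≤-refl , m≤n+m (k * w) w , ∣n⇒∣m*n k h∣w
      range (inj₂ refl) = m≤n+m (k * w) w , ≤-refl , ∣n⇒∣m*n (suc k) h∣w
      kw≤c = proj₁ (range c≡)
      c≤kw+w = proj₁ (proj₂ (range c≡))
      h∣c = proj₂ (proj₂ (range c≡))
      offset : ∀ {z} → Guard c z → c ≤ z + h × z ≤ c + h × h ∣ z
      offset at            = m≤m+n c h , m≤m+n c h , h∣c
      offset after         = ≤-trans (m≤m+n c h) (m≤m+n (c + h) h) , ≤-refl , ∣m∣n⇒∣m+n h∣c ∣-refl
      offset (before refl) = ≤-refl , ≤-trans (m≤m+n _ h) (m≤m+n (_ + h) h) , ∣m+n∣m⇒∣n (subst (h ∣_) (+-comm _ h) h∣c) ∣-refl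
    guarded : ∀ {z} → Guarded z → All (λ S → (z , z) ∉ contacts S) past
    guarded (_ , break-i , g)  with guard-near {i} (inj₁ refl) g
    ... | l , u , d = good⇒noContact past (≤-reflexive len) gi l u d
    guarded (_ , break-i′ , g) with guard-near {i} (inj₂ refl) g
    ... | l , u , d = good⇒noContact past (≤-reflexive len) gi l u d
    guarded (_ , break-j , g)  with guard-near {j} (inj₁ refl) g
    ... | l , u , d = good⇒noContact past (≤-reflexive len) gj l u d
    guarded (_ , break-j′ , g) with guard-near {j} (inj₂ refl) g
    ... | l , u , d = good⇒noContact past (≤-reflexive len) gj l u d
    noContacts : All (λ S → ∀ {z} → Guarded z → (z , z) ∉ contacts S) past
    noContacts = All.tabulate λ S∈ g → All.lookup (guarded g) S∈

-- The number of bad points along R rounds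

n<2^n : ∀ n → n < 2 ^ n
n<2^n zero    = s≤s z≤n
n<2^n (suc n) = begin-strict
  suc n           ≤⟨ n<2^n n ⟩
  2 ^ n           <⟨ ^-monoʳ-< 2 (s≤s (s≤s z≤n)) (n<1+n n) ⟩
  2 ^ suc n       ∎
  where open ≤-Reasoning

2^-cancel-≤ : ∀ {m n} → 2 ^ m ≤ 2 ^ n → m ≤ n
2^-cancel-≤ le = ≮⇒≥ λ n<m → <⇒≱ (^-monoʳ-< 2 (s≤s (s≤s z≤n)) n<m) le

-- Here c counts the contacts, a the targets, q the good blocks, b the older bad points and nw all
-- blocks; c * 4 + a * 3 bounds the forbidden exchanges.
pairs-suffice : ∀ {c z X a q b nw} → c ≤ z → z * 8 ≤ X * nw → X < a →
  nw ≤ q + (2 + b * 3) → 10 + b * 6 ≤ nw → c * 4 + a * 3 < a * q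
pairs-suffice {c} {z} {X} {a} {q} {b} {nw} c≤z z≤ X<a nw≤ ≤nw = begin-strict
  c * 4 + a * 3               <⟨ +-monoˡ-< (a * 3) (*-cancelʳ-< 2 (c * 4) (a * q′) doubled) ⟩
  a * q′ + a * 3              ≡⟨ *-distribˡ-+ a q′ 3 ⟨
  a * (q′ + 3)                ≡⟨ cong (a *_) (m∸n+n≡m 3≤q) ⟩
  a * q                       ∎
  where
  open ≤-Reasoning
  -- Three good blocks per target are set aside to pay for `a * 3`. The remaining ones are still at
  -- least half of all blocks, which is enough to pay for `c * 4`.
  q′ = q ∸ 3
  nw+6≤q*2 : nw + 6 ≤ q * 2
  nw+6≤q*2 = +-cancelʳ-≤ (4 + b * 6) (nw + 6) (q * 2) (begin
    nw + 6 + (4 + b * 6)          ≡⟨ +-assoc nw 6 (4 + b * 6) ⟩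
    nw + (10 + b * 6)             ≤⟨ +-monoʳ-≤ nw ≤nw ⟩
    nw + nw                       ≤⟨ +-mono-≤ nw≤ nw≤ ⟩
    q + (2 + b * 3) + (q + (2 + b * 3)) ≡⟨ rearrange q b ⟩
    q * 2 + (4 + b * 6)           ∎)
    where
    rearrange : ∀ q b → q + (2 + b * 3) + (q + (2 + b * 3)) ≡ q * 2 + (4 + b * 6)
    rearrange = solve-∀
  3≤q : 3 ≤ q
  3≤q = *-cancelʳ-≤ 3 q 2 (≤-trans (m≤n+m 6 nw) nw+6≤q*2)
  nw≤q′*2 : nw ≤ q′ * 2
  nw≤q′*2 = +-cancelʳ-≤ 6 nw (q′ * 2) (begin
    nw + 6           ≤⟨ nw+6≤q*2 ⟩
    q * 2            ≡⟨ cong (_* 2) (m∸n+n≡m 3≤q) ⟨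
    (q′ + 3) * 2     ≡⟨ *-distribʳ-+ 2 q′ 3 ⟩
    q′ * 2 + 6       ∎)
  instance
    nw≢0 : NonZero nw
    nw≢0 = >-nonZero (≤-trans (s≤s z≤n) ≤nw)
  doubled : c * 4 * 2 < a * q′ * 2
  doubled = begin-strict
    c * 4 * 2        ≡⟨ *-assoc c 4 2 ⟩
    c * 8            ≤⟨ *-monoˡ-≤ 8 c≤z ⟩
    z * 8            ≤⟨ z≤ ⟩
    X * nw           <⟨ *-monoˡ-< nw X<a ⟩
    a * nw           ≤⟨ *-monoʳ-≤ a nw≤q′*2 ⟩
    a * (q′ * 2)     ≡⟨ *-assoc a q′ 2 ⟨
    a * q′ * 2       ∎

fresh-multiple : ∀ w .{{_ : NonZero w}} b ks → suc (length ks) < b → ∃ λ z → 0 < z × z < b * w × w ∣ z × z ∉ ks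
fresh-multiple w (suc b) ks (s≤s lt)
  with ∃-outside _≟_ {map (λ k → suc k * w) (upTo b)} {ks}
         (Unique.map⁺ (λ {k} {l} eq → suc-injective (*-cancelʳ-≡ (suc k) (suc l) w eq)) (Unique.upTo⁺ b))
         (subst (length ks <_) (sym (trans (length-map _ (upTo b)) (length-upTo b))) lt)
... | z , z∈ , z∉ with ∈-map⁻ (λ k → suc k * w) z∈
... | k , k∈ , refl = suc k * w , ≤-trans (>-nonZero⁻¹ w) (m≤n*m w (suc k))
                    , *-monoˡ-< w (s≤s (∈-upTo⁻ k∈)) , n∣m*n (suc k) , z∉

module LowerBound (P M : ℕ) (s : Strategy P M) (n R : ℕ) (PM≡2^n : P * M ≡ 2 ^ n)
  (large : 2 ^ (6 * R + 12) ≤ P) (solves : SolvesWithin P M s R) where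

  open Invariants P M s
  open Premature P M s

  0<M : 0 < M
  0<M = n≢0⇒n>0 λ { refl → <-irrefl (trans (sym (*-zeroʳ P)) PM≡2^n) (m^n>0 2 n) }

  6R+12≤n : 6 * R + 12 ≤ n
  6R+12≤n = 2^-cancel-≤ (≤-trans large (subst (P ≤_) PM≡2^n (m≤m*n P M {{>-nonZero 0<M}})))

  opaque

    -- With more than X targets in a round, some exchange is not forbidden.
    X : ℕ
    X = 2 ^ (2 * R + 4) * M

    -- Bounds the number of bad points of all rounds before `t`. The factor 8 per round leaves room
    -- for the `6 * β t` found in `reduced`.
    β : ℕ → ℕ
    β t = 2 ^ (3 * t) * X

    blocks : ℕ → ℕ
    blocks t = 2 ^ (n ∸ suc t)

    PM≡blocks : ∀ {t} → t ≤ R → P * M ≡ blocks t * 2 ^ suc t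
    PM≡blocks {t} t≤R = trans PM≡2^n (trans (cong (2 ^_) (sym (m∸n+n≡m st≤n))) (^-distribˡ-+-* 2 (n ∸ suc t) (suc t)))
      where
      st≤n : suc t ≤ n
      st≤n = begin
        suc t         ≤⟨ s≤s t≤R ⟩
        suc R         ≤⟨ +-mono-≤ (s≤s (z≤n {11})) (m≤n*m R 6) ⟩
        12 + 6 * R    ≡⟨ +-comm 12 (6 * R) ⟩
        6 * R + 12    ≤⟨ 6R+12≤n ⟩
        n             ∎
        where open ≤-Reasoning

    2≤X : 2 ≤ X
    2≤X = *-mono-≤ {2} {2 ^ (2 * R + 4)} (subst (2 ≤_) (cong (2 ^_) (+-comm 4 (2 * R))) (*-monoʳ-≤ 2 (m^n>0 2 (3 + 2 * R)))) 0<M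

    β-mono : ∀ {t u} → t ≤ u → β t ≤ β u
    β-mono t≤u = *-monoˡ-≤ X (^-monoʳ-≤ 2 (*-monoʳ-≤ 3 t≤u))

    X≤β : ∀ t → X ≤ β t
    X≤β t = m≤n*m X (2 ^ (3 * t)) {{m^n≢0 2 (3 * t)}}

    β-suc : ∀ t → β (suc t) ≡ 8 * β t
    β-suc t = trans (cong (_* X) (trans (cong (2 ^_) (*-suc 3 t)) (^-distribˡ-+-* 2 3 (3 * t)))) (*-assoc 8 (2 ^ (3 * t)) X)

    -- Here the size of `P` enters: 16, `β (suc R)` without its factor `M`, and the largest block
    -- size have exponents adding up to `6 * R + 12`.
    16β≤blocks : ∀ {t} → t ≤ R → 16 * β (suc R) ≤ blocks t
    16β≤blocks {t} t≤R = *-cancelʳ-≤ _ _ (2 ^ suc t) {{m^n≢0 2 (suc t)}} (begin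
      16 * β (suc R) * 2 ^ suc t                                    ≤⟨ *-monoʳ-≤ (16 * β (suc R)) (^-monoʳ-≤ 2 (s≤s t≤R)) ⟩
      16 * (2 ^ (3 * suc R) * (2 ^ (2 * R + 4) * M)) * 2 ^ suc R    ≡⟨ collect (2 ^ (3 * suc R)) (2 ^ (2 * R + 4)) (2 ^ suc R) M ⟩
      2 ^ 4 * 2 ^ (3 * suc R) * 2 ^ (2 * R + 4) * 2 ^ suc R * M     ≡⟨ cong (_* M) exponents ⟩
      2 ^ (6 * R + 12) * M                                          ≤⟨ *-monoˡ-≤ M large ⟩
      P * M                                                         ≡⟨ PM≡blocks t≤R ⟩
      blocks t * 2 ^ suc t                                          ∎)
      where
      open ≤-Reasoning
      collect : ∀ x y z m → 16 * (x * (y * m)) * z ≡ 16 * x * y * z * m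
      collect = solve-∀
      sum : ∀ R → 4 + 3 * suc R + (2 * R + 4) + suc R ≡ 6 * R + 12
      sum = solve-∀
      exponents : 2 ^ 4 * 2 ^ (3 * suc R) * 2 ^ (2 * R + 4) * 2 ^ suc R ≡ 2 ^ (6 * R + 12)
      exponents = begin-equality
        2 ^ 4 * 2 ^ (3 * suc R) * 2 ^ (2 * R + 4) * 2 ^ suc R   ≡⟨ cong (λ x → x * 2 ^ (2 * R + 4) * 2 ^ suc R) (^-distribˡ-+-* 2 4 (3 * suc R)) ⟨
        2 ^ (4 + 3 * suc R) * 2 ^ (2 * R + 4) * 2 ^ suc R       ≡⟨ cong (_* 2 ^ suc R) (^-distribˡ-+-* 2 (4 + 3 * suc R) (2 * R + 4)) ⟨
        2 ^ (4 + 3 * suc R + (2 * R + 4)) * 2 ^ suc R           ≡⟨ ^-distribˡ-+-* 2 (4 + 3 * suc R + (2 * R + 4)) (suc R) ⟨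
        2 ^ (4 + 3 * suc R + (2 * R + 4) + suc R)               ≡⟨ cong (2 ^_) (sum R) ⟩
        2 ^ (6 * R + 12)                                        ∎

    -- The choice of `X` comes from here: `suc t` is at most `2 ^ R` and the block size at most
    -- `2 ^ suc R`, and together with the factor 8 they give `2 ^ (2 * R + 4)`.
    contacts-few : ∀ {t} → t ≤ R → suc t * (P * (M * M)) * 8 ≤ X * blocks t
    contacts-few {t} t≤R = begin
      suc t * (P * (M * M)) * 8                       ≡⟨ regroup (suc t) P M ⟩
      suc t * 8 * M * (P * M)                         ≡⟨ cong (suc t * 8 * M *_) (PM≡blocks t≤R) ⟩
      suc t * 8 * M * (blocks t * 2 ^ suc t)          ≡⟨ regroup′ (suc t) M (blocks t) (2 ^ suc t) ⟩
      suc t * 2 ^ suc t * (8 * M * blocks t)          ≤⟨ *-monoˡ-≤ (8 * M * blocks t) (*-mono-≤ (≤-trans (n<2^n t) (^-monoʳ-≤ 2 t≤R)) (^-monoʳ-≤ 2 (s≤s t≤R))) ⟩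
      2 ^ R * 2 ^ suc R * (8 * M * blocks t)          ≡⟨ regroup″ (2 ^ R) (2 ^ suc R) M (blocks t) ⟩
      8 * 2 ^ R * 2 ^ suc R * M * blocks t            ≡⟨ cong (λ x → x * M * blocks t) exponents ⟩
      X * blocks t                                    ∎
      where
      open ≤-Reasoning
      regroup : ∀ t p m → t * (p * (m * m)) * 8 ≡ t * 8 * m * (p * m)
      regroup = solve-∀
      regroup′ : ∀ t m b w → t * 8 * m * (b * w) ≡ t * w * (8 * m * b)
      regroup′ = solve-∀
      regroup″ : ∀ x y m b → x * y * (8 * m * b) ≡ 8 * x * y * m * b
      regroup″ = solve-∀
      sum : ∀ R → 3 + R + suc R ≡ 2 * R + 4
      sum = solve-∀
      exponents : 8 * 2 ^ R * 2 ^ suc R ≡ 2 ^ (2 * R + 4)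
      exponents = trans (cong (_* 2 ^ suc R) (sym (^-distribˡ-+-* 2 3 R)))
        (trans (sym (^-distribˡ-+-* 2 (3 + R) (suc R))) (cong (2 ^_) (sum R)))

  -- The beginning of round `t`, with a bound for the earlier rounds only; `Reduced` includes round
  -- `t`.
  record Stage (t : ℕ) : Set where
    constructor stage
    field
      {perm}  : Perm P M
      {past}  : List State
      {now}   : State
      history : History perm (now ∷ past)
      length≡ : length past ≡ t
      few     : length (bads past) ≤ β t

  -- While the bound fails, there are more than `X` targets and an improvement exists. It lowers the
  -- number of bad points of round `t`, for which `k` serves as fuel, without raising the total of
  -- the earlier rounds.
  reduce : ∀ {t} → t ≤ R → ∀ k (S : Stage t) → length (badsOf t (Stage.now S)) ≤ k →
    ∃ λ (S′ : Stage t) → length (badsOf t (Stage.now S′)) ≤ X + (2 + β t * 3)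
  reduce {t} t≤R k S le with length (badsOf t (Stage.now S)) ≤? X + (2 + β t * 3)
  ... | yes fine = S , fine
  reduce {t} t≤R zero    S le | no many = contradiction (≤-trans le z≤n) many
  reduce {t} t≤R (suc k) (stage {π} {past} {now} H len few) le | no many =
    reduce t≤R k (stage (Improved.history imp) (trans (Improved.length≡ imp) len) (≤-trans (Improved.past≤ imp) few))
      (≤-pred (≤-trans (Improved.now< imp) le))
    where
    instance
      2^≢0 : NonZero (2 ^ suc t)
      2^≢0 = m^n≢0 2 (suc t)
    open Improve P M s t (2 ^ suc t) refl (blocks t) (PM≡blocks t≤R)
    X<targets : X < length (targets past now)
    X<targets = +-cancelʳ-< (2 + β t * 3) X (length (targets past now)) (<-≤-trans (≰⇒> many)
      (≤-trans (badsOf≤ past now) (+-monoʳ-≤ (length (targets past now)) (+-monoʳ-≤ 2 (*-monoˡ-≤ 3 few)))))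
    10+≤blocks : 10 + length (bads past) * 6 ≤ blocks t
    10+≤blocks = begin
      10 + length (bads past) * 6         ≤⟨ +-mono-≤ (*-monoʳ-≤ 5 (≤-trans 2≤X (X≤β (suc R)))) (*-monoˡ-≤ 6 (≤-trans few (β-mono (≤-trans t≤R (n≤1+n R))))) ⟩
      5 * β (suc R) + β (suc R) * 6       ≡⟨ cong (5 * β (suc R) +_) (*-comm (β (suc R)) 6) ⟩
      5 * β (suc R) + 6 * β (suc R)       ≡⟨ *-distribʳ-+ (β (suc R)) 5 6 ⟨
      11 * β (suc R)                      ≤⟨ *-monoˡ-≤ (β (suc R)) {11} {16} (m≤m+n 11 5) ⟩
      16 * β (suc R)                      ≤⟨ 16β≤blocks t≤R ⟩
      blocks t                            ∎
      where open ≤-Reasoning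
    imp : Improved past now
    imp = improve H len (≤-<-trans (length-forbidden past now) (pairs-suffice {b = length (bads past)}
      (≤-trans (length-allContacts H) (≤-reflexive (cong (λ l → suc l * (P * (M * M))) len)))
      (contacts-few t≤R) X<targets (nw≤ past) 10+≤blocks))

  record Reduced (t : ℕ) : Set where
    field
      {perm}  : Perm P M
      {past}  : List State
      {now}   : State
      history : History perm (now ∷ past)
      length≡ : length past ≡ t
      few     : length (bads (now ∷ past)) ≤ β (suc t)

  reduced : ∀ {t} → t ≤ R → Stage t → Reduced t
  reduced {t} t≤R S with reduce t≤R _ S ≤-refl
  ... | stage {past = past} {now} H refl few , now≤ = record { history = H ; length≡ = refl ; few = begin
    length (badsOf t now ++ bads past)               ≡⟨ length-++ (badsOf t now) ⟩
    length (badsOf t now) + length (bads past)       ≤⟨ +-mono-≤ now≤ few ⟩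
    X + (2 + β t * 3) + β t                          ≤⟨ +-monoˡ-≤ (β t) (+-mono-≤ (X≤β t) (+-monoˡ-≤ (β t * 3) (≤-trans 2≤X (X≤β t)))) ⟩
    β t + (β t + β t * 3) + β t                      ≡⟨ six (β t) ⟩
    6 * β t                                          ≤⟨ *-monoˡ-≤ (β t) {6} {8} (m≤m+n 6 2) ⟩
    8 * β t                                          ≡⟨ β-suc t ⟨
    β (suc t)                                        ∎ }
    where
    open ≤-Reasoning
    six : ∀ x → x + (x + x * 3) + x ≡ 6 * x
    six = solve-∀

  -- By uniqueness the shorter history is a tail of the longer one.
  history-embeds : ∀ {π as bs} {Q : State → Set} → History π as → History π bs → ∀ k → length bs ≡ k + length as →
    All Q bs → All Q as
  history-embeds H H′ zero eq qs with History-unique _ H H′ (sym eq)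
  ... | refl = qs
  history-embeds start       start (suc k) eq qs = contradiction (trans (suc-injective eq) (+-comm k 1)) λ()
  history-embeds (round _ _) start (suc k) eq qs = contradiction (trans (suc-injective eq) (+-suc k _)) λ()
  history-embeds H (round H′ _) (suc k) eq (_ ∷ qs) = history-embeds H H′ k (suc-injective eq) qs

  history-extends : ∀ {π A As bs} → History π (A ∷ As) → History π bs → ∀ k → length bs ≡ suc k + length (A ∷ As) →
    ∃ λ S → History π (S ∷ A ∷ As)
  history-extends H start k eq = contradiction (trans (suc-injective eq) (+-suc k _)) λ()
  history-extends H (round H′ R′) zero eq with History-unique _ H H′ (sym (suc-injective eq))
  ... | refl = _ , round H′ R′
  history-extends H (round H′ _) (suc k) eq = history-extends H H′ k (suc-injective eq)

  untouched : ∀ {ks} → length ks ≤ β (suc R) → ∃ λ z → 0 < z × z < P * M × 2 ^ suc R ∣ z × z ∉ ks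
  untouched {ks} le with fresh-multiple (2 ^ suc R) {{m^n≢0 2 (suc R)}} (blocks R) ks (begin-strict
      suc (length ks)              ≤⟨ s≤s le ⟩
      1 + β (suc R)                <⟨ +-monoˡ-≤ (β (suc R)) (≤-trans 2≤X (X≤β (suc R))) ⟩
      β (suc R) + β (suc R)        ≡⟨ cong (β (suc R) +_) (+-identityʳ (β (suc R))) ⟨
      2 * β (suc R)                ≤⟨ *-monoˡ-≤ (β (suc R)) {2} {16} (m≤m+n 2 14) ⟩
      16 * β (suc R)               ≤⟨ 16β≤blocks {R} ≤-refl ⟩
      blocks R                     ∎)
    where open ≤-Reasoning
  ... | z , 0<z , z< , 2^∣z , z∉ = z , 0<z , subst (z <_) (sym (PM≡blocks {R} ≤-refl)) z< , 2^∣z , z∉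

  -- Up to round `t` the solving run follows the constructed history. Some multiple of `2 ^ suc R`
  -- is never bad in it, so it is uncrossed even in the middle of that round, and no atom represents
  -- the whole interval.
  not-yet-solved : ∀ {t} → t ≤ R → (S : Reduced t) → ∀ {c} (I : MidRound (Reduced.perm S) c) →
    HasFull P M (Reduced.perm S) s c → t < length (MidRound.past I)
  not-yet-solved {t} t≤R S {c} I (p , full) with t <? length (MidRound.past I)
  ... | yes t<r = t<r
  ... | no t≮r with untouched (≤-trans (Reduced.few S) (β-mono (s≤s t≤R))) | find full
  ...   | z , 0<z , z<N , 2^∣z , z∉ | x , x∈ , lo≡0 , hi≡N = ⊥-elim (crossed (All.lookup uncrossed x∈))
    where
    open MidRound I
    k = suc t ∸ length (now ∷ past)
    len : length (Reduced.now S ∷ Reduced.past S) ≡ k + length (now ∷ past)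
    len = trans (cong suc (Reduced.length≡ S)) (sym (m∸n+n≡m (s≤s (≮⇒≥ t≮r))))
    noContacts : All (λ S → (z , z) ∉ contacts S) (now ∷ past)
    noContacts = history-embeds history (Reduced.history S) k len
      (∉bads⇒noContact {k = suc R} 0<z z<N 2^∣z (s≤s (subst (_≤ R) (sym (Reduced.length≡ S)) t≤R)) z∉)
    uncrossed : AllIv (Uncrossed z) (mems c p)
    uncrossed = unfusable⇒uncrossed {z} (run-unfusable {z = z} (runs p)
      (noContact⇒unfusable {now} {p} {z} (All.head noContacts) (history-uncrossed history (All.tail noContacts) p)))
    crossed : ¬ Uncrossed z (lo P M x) (hi P M x)
    crossed (inj₁ hi≤z) = <⇒≱ z<N (subst (_≤ z) hi≡N hi≤z)
    crossed (inj₂ z≤lo) = <⇒≱ 0<z (subst (z ≤_) lo≡0 z≤lo)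

  final-round : ∀ {t} → t ≤ R → (S : Reduced t) → ∃ λ c → ∃ λ (I : MidRound (Reduced.perm S) c) →
    length (MidRound.past I) ≤ R × t < length (MidRound.past I)
  final-round t≤R S with solves (Reduced.perm S)
  ... | c , steps , r≤R , full = c , I , subst (_≤ R) (MidRound.rnd≡ I) r≤R , not-yet-solved t≤R S I full
    where I = MidRound-star (Reduced.perm S) steps (MidRound-init (Reduced.perm S))

  -- The run that solves the problem for the present permutation lasts beyond round `t`, and by
  -- uniqueness it continues the constructed history. This supplies the next state.
  extend : ∀ {t} → t ≤ R → Reduced t → Stage (suc t)
  extend {t} t≤R S with final-round t≤R S
  ... | c , I , _ , t<r with history-extends (Reduced.history S) (MidRound.history I) (length (MidRound.past I) ∸ suc t)
        (cong suc (trans (sym (m∸n+n≡m t<r)) (cong (λ l → length (MidRound.past I) ∸ suc t + suc l) (sym (Reduced.length≡ S)))))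
  ...   | S′ , H′ = stage H′ (cong suc (Reduced.length≡ S)) (Reduced.few S)

  stages : ∀ t → t ≤ R → Stage t
  -- Any permutation serves at the beginning, as there are no earlier rounds to have bad points.
  stages zero    _   = stage {perm = ↔-sym *↔×} start refl z≤n
  stages (suc t) t<R = extend (<⇒≤ t<R) (reduced (<⇒≤ t<R) (stages t (<⇒≤ t<R)))

  unsolvable : ⊥
  unsolvable with final-round ≤-refl (reduced ≤-refl (stages R ≤-refl))
  ... | _ , _ , r≤R , R<r = <⇒≱ R<r r≤R

-- The logarithmic bound for `P` and `M` of the same order

theorem6 : ∀ (a : ℕ) → ∃ λ (d : ℕ) → ∃ λ (n₀ : ℕ) →
    ∀ (n P M : ℕ) → n₀ ≤ n → P * M ≡ 2 ^ n → M ≤ a * P → P ≤ a * M →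
    (s : Strategy P M) (R : ℕ) → SolvesWithin P M s R → n ≤ d * R
-- If `P` were below `2 ^ (6 * R + 12)`, then `P * M ≤ a * P * P` would give
-- `n ≤ a + 2 * (6 * R + 12)`. Doubled, the right side is `24 * R + (2 * a + 48)`, which is less
-- than `n + n` when `24 * R < n` and `2 * a + 48 ≤ n`.
theorem6 a = 24 , 2 * a + 48 , bound
  where
  bound : ∀ (n P M : ℕ) → 2 * a + 48 ≤ n → P * M ≡ 2 ^ n → M ≤ a * P → P ≤ a * M →
    (s : Strategy P M) (R : ℕ) → SolvesWithin P M s R → n ≤ 24 * R
  bound n P M n₀≤n PM≡ M≤aP _ s R solves =
    ≮⇒≥ λ 24R<n → LowerBound.unsolvable P M s n R PM≡ (≮⇒≥ (P-not-small 24R<n)) solves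
    where
    open ≤-Reasoning
    P-not-small : 24 * R < n → ¬ P < 2 ^ (6 * R + 12)
    P-not-small 24R<n P<2^k = <-irrefl refl (begin-strict
      n + n                                ≤⟨ +-mono-≤ n≤ n≤ ⟩
      a + (k + k) + (a + (k + k))          ≡⟨ rearrange a R ⟩
      24 * R + (2 * a + 48)                <⟨ +-mono-<-≤ 24R<n n₀≤n ⟩
      n + n                                ∎)
      where
      k = 6 * R + 12
      rearrange : ∀ a R → a + (6 * R + 12 + (6 * R + 12)) + (a + (6 * R + 12 + (6 * R + 12))) ≡ 24 * R + (2 * a + 48)
      rearrange = solve-∀
      n≤ : n ≤ a + (k + k)
      n≤ = 2^-cancel-≤ (begin
        2 ^ n                      ≡⟨ PM≡ ⟨
        P * M                      ≤⟨ *-monoʳ-≤ P M≤aP ⟩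
        P * (a * P)                ≤⟨ *-mono-≤ (<⇒≤ P<2^k) (*-mono-≤ (<⇒≤ (n<2^n a)) (<⇒≤ P<2^k)) ⟩
        2 ^ k * (2 ^ a * 2 ^ k)    ≡⟨ cong (2 ^ k *_) (^-distribˡ-+-* 2 a k) ⟨
        2 ^ k * 2 ^ (a + k)        ≡⟨ ^-distribˡ-+-* 2 k (a + k) ⟨
        2 ^ (k + (a + k))          ≡⟨ cong (2 ^_) (trans (sym (+-assoc k a k)) (trans (cong (_+ k) (+-comm k a)) (+-assoc a k k))) ⟩
        2 ^ (a + (k + k))          ∎)
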